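{- For every tournament $T=(V,E)$ on $n$ vertices, $$c(T,5) \ge \frac{3}{4}\binom{n}{5} - \frac{1}{2}\binom{n-2}{2}\sum_{w\in V}\left(od(w)-\frac{n-1}{2}\right)^2 - \frac{3}{8}\binom{n}{3},$$ where $c(T,5)$ is the number of directed 5-cycles in $T$ and $od(w)$ is the out-degree of the vertex $w$ in $T$.
   Context: A tournament on $n$ vertices (an $n$-tournament) is a directed graph $T=(V,E)$ with $|V|=n$, without loops, such that for every pair of distinct vertices $u,v$ exactly one of $(u,v),(v,u)$ lies in $E$. The quantity $c(T,k)$ is the number of directed $k$-cycles of $T$, counted as subgraphs (i.e. cyclic rotations of the same vertex sequence give the same cycle). The out-degree is $od(w)=|\{x\in V : (w,x)\in E\}|$. -}

module Defs where

open import Data.Fin.Base using (Fin; toℕ)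
open import Data.Fin.Properties using (_≟_; any?)
open import Data.Integer.Base using (+_)
open import Data.List.Base using (List; []; _∷_; allFin; cartesianProductWith; deduplicate; filter; length)
open import Data.Nat.Base using (ℕ; zero; suc)
open import Data.Nat.GeneralisedArithmetic using (iterate)
open import Data.Product.Base using (_×_; _,_; ∃)
open import Data.Rational.Base as ℚ using (ℚ)
open import Data.Sum.Base using (_⊎_; inj₁; inj₂)
open import Data.Vec.Base as Vec using (Vec; _∷ʳ_)
open import Data.Vec.Properties using (≡-dec)
open import Data.Vec.Relation.Binary.Pointwise.Inductive as Pointwise using (Pointwise)
import Data.Vec.Relation.Unary.AllPairs as AllPairs
open import Data.Vec.Relation.Unary.Unique.Propositional using (Unique)
open import Level using (0ℓ)
open import Relation.Binary.Core using (Rel)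
open import Relation.Binary.Definitions using (Decidable)
open import Relation.Binary.PropositionalEquality.Core using (_≡_; _≢_; refl)
open import Relation.Nullary.Decidable using (yes; no; ¬?; _×-dec_)
open import Relation.Nullary.Negation.Core using (¬_)
import Relation.Unary as U

record Tournament (n : ℕ) : Set₁ where
  field
    E          : Rel (Fin n) 0ℓ
    loopless   : ∀ u → ¬ E u u
    exactlyOne : ∀ {u v} → u ≢ v → (E u v × ¬ E v u) ⊎ (¬ E u v × E v u)

  E? : Decidable E
  E? u v with u ≟ v
  ... | yes refl = no (loopless u)
  ... | no u≢v with exactlyOne u≢v
  ...   | inj₁ (e , _)  = yes e
  ...   | inj₂ (¬e , _) = no ¬e

  od : Fin n → ℕ
  od w = length (filter (E? w) (allFin n))

rotate : ∀ {A : Set} {k} → Vec A k → Vec A k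
rotate Vec.[]       = Vec.[]
rotate (x Vec.∷ xs) = xs ∷ʳ x

_IsRotationOf_ : ∀ {n k} → Rel (Vec (Fin n) k) 0ℓ
_IsRotationOf_ {k = k} w v = ∃ λ (i : Fin k) → w ≡ iterate rotate v (toℕ i)

isRotationOf? : ∀ {n k} → Decidable (_IsRotationOf_ {n} {k})
isRotationOf? w v = any? λ i → ≡-dec _≟_ w (iterate rotate v (toℕ i))

allVecs : ∀ n k → List (Vec (Fin n) k)
allVecs n zero    = Vec.[] ∷ []
allVecs n (suc k) = cartesianProductWith Vec._∷_ (allFin n) (allVecs n k)

module _ {n : ℕ} (T : Tournament n) where
  open Tournament T

  -- Comparing v with rotate v pointwise says v₀ → v₁ → ⋯ → vₖ₋₁ → v₀.
  IsCycle : ∀ {k} → U.Pred (Vec (Fin n) k) 0ℓ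
  IsCycle v = Unique v × Pointwise E v (rotate v)

  isCycle? : ∀ {k} → U.Decidable (IsCycle {k})
  isCycle? v = AllPairs.allPairs? (λ x y → ¬? (x ≟ y)) v
         ×-dec Pointwise.decidable E? v (rotate v)

  -- Deduplicating up to rotation keeps one vertex sequence per directed
  -- cycle, so each cycle is counted once (for k ≥ 1).
  c : ℕ → ℕ
  c k = length (deduplicate isRotationOf? (filter isCycle? (allVecs n k)))

fromℕ : ℕ → ℚ
fromℕ m = + m ℚ./ 1

infix 11 _²
_² : ℚ → ℚ
x ² = x ℚ.* x

{-# OPTIONS --safe #-}
module Submission where

-- Let x a b = ±1 according to whether a → b or b → a.  The number of closed
-- walks of length 5 on distinct vertices is the sum of ∏ (1 + x)/2 over ordered
-- 5-tuples.  Reversing a tuple cancels the odd part of the product, and its even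
-- part consists of 1, of the rotations of x a b · x b c and of the rotations of
-- the 4-edge path x a b · x b c · x c d · x d e (two disjoint edges sum to 0).
-- By inclusion–exclusion on coinciding vertices the first path sum is
-- n (n − 1) − R, where R = Σ (2 od − (n − 1))², and the second is the square sum
-- Σ (A² 1)², A being the matrix x, minus a sum over closed 4-tuples and multiples
-- of R.  Dropping the squares and bounding every closed 4-tuple by 1 leaves
-- (n² − 6 n + 6) R + n (n − 1)² ≥ 0 to be checked, which is clear for n ≥ 5; for
-- n ≤ 4 the right-hand side of the corollary is not positive.

open import Defs
open import Data.Bool.Base using (true; false; if_then_else_)
open import Data.Fin.Base using (Fin; zero; suc; toℕ)
open import Data.Fin.Properties using (_≟_; punchInᵢ≢i; toℕ<n)
open import Data.Integer.Base as ℤ using (ℤ; +_; 0ℤ; 1ℤ; -1ℤ)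
import Data.Integer.Properties as ℤ
open import Data.Integer.Tactic.RingSolver using (solve-∀)
open import Data.List.Base using (List; []; _∷_; _++_; length; foldr; filter; map; tabulate; concatMap; cartesianProductWith; deduplicate)
open import Data.List.Membership.Propositional using (_∈_)
open import Data.List.Membership.Propositional.Properties using (∈-∃++; ∈-++⁺ˡ; ∈-++⁺ʳ; ∈-++⁻; ∈-concatMap⁺; ∈-tabulate⁺)
open import Data.List.Properties using (length-++; length-++-sucʳ; filter-++)
open import Data.List.Relation.Binary.Permutation.Propositional as ↭ using (_↭_)
open import Data.List.Relation.Binary.Subset.Propositional using (_⊆_)
open import Data.List.Relation.Unary.All as All using (All; []; _∷_)
open import Data.List.Relation.Unary.AllPairs using (AllPairs; []; _∷_)
open import Data.List.Relation.Unary.Any as Any using (here; there)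
import Data.List.Relation.Unary.Any.Properties as Any
open import Data.List.Relation.Unary.Unique.Propositional using () renaming (Unique to Uniqueˡ)
import Data.List.Relation.Unary.Unique.Propositional.Properties as Unique
open import Data.Nat.Base as ℕ using (ℕ; zero; suc; z≤n; s≤s; _∸_; _!)
open import Data.Nat.Combinatorics using (_C_; k>n⇒nCk≡0; nCk+nC[k+1]≡[n+1]C[k+1])
open import Data.Nat.GeneralisedArithmetic using (iterate)
import Data.Nat.Properties as ℕ
open import Data.Product.Base using (_×_; _,_; ∃; uncurry)
open import Data.Sum.Base using (_⊎_; inj₁; inj₂)
open import Data.Vec.Base using (Vec; []; _∷_)
open import Data.Vec.Functional using (removeAt)
open import Data.Vec.Properties using (∷-injective)
open import Data.Vec.Relation.Binary.Pointwise.Inductive using ([]; _∷_)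
open import Data.Vec.Relation.Unary.All using ([]; _∷_)
open import Data.Vec.Relation.Unary.AllPairs using ([]; _∷_)
open import Function.Base using (_∘_; id)
open import Relation.Binary.PropositionalEquality using (_≡_; _≢_; refl; sym; trans; cong; cong₂; subst; ≢-sym; module ≡-Reasoning)
open import Relation.Nullary.Decidable using (Dec; does; yes; no)
open import Relation.Nullary.Negation using (contradiction)
import Relation.Unary as U
import Algebra.Properties.Semiring.Sum ℤ.+-*-semiring as Sum

module _ where
  open import Data.Integer.Base using (_+_; _*_; _-_; -_; _≤_; +≤+; -≤+)

  -- Finite sums of integers.

  variable n k : ℕ

  -- Opaque, so that ∑ is injective for unification.
  opaque
    ∑ : (Fin n → ℤ) → ℤ
    ∑ = Sum.sum

    ∑-cong : {f g : Fin n → ℤ} → (∀ i → f i ≡ g i) → ∑ f ≡ ∑ g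
    ∑-cong = Sum.sum-cong-≗

    ∑-comm : (f : Fin n → Fin n → ℤ) → ∑ (λ i → ∑ λ j → f i j) ≡ ∑ (λ j → ∑ λ i → f i j)
    ∑-comm = Sum.∑-comm

    ∑-+ : (f g : Fin n → ℤ) → ∑ (λ i → f i + g i) ≡ ∑ f + ∑ g
    ∑-+ = Sum.∑-distrib-+

    ∑-* : ∀ c (f : Fin n → ℤ) → ∑ (λ i → c * f i) ≡ c * ∑ f
    ∑-* c f = sym (Sum.*-distribˡ-sum c f)

    ∑-mono : {f g : Fin n → ℤ} → (∀ i → f i ≤ g i) → ∑ f ≤ ∑ g
    ∑-mono {zero}  f≤g = ℤ.≤-refl
    ∑-mono {suc n} f≤g = ℤ.+-mono-≤ (f≤g zero) (∑-mono λ i → f≤g (suc i))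

    ∑-const : ∀ n c → ∑ {n} (λ _ → c) ≡ + n * c
    ∑-const zero    c = sym (ℤ.*-zeroˡ c)
    ∑-const (suc n) c = trans (cong (_+_ c) (∑-const n c)) (sym (ℤ.suc-* (+ n) c))

    ∑-single : (f : Fin n → ℤ) (i : Fin n) → (∀ j → i ≢ j → f j ≡ 0ℤ) → ∑ f ≡ f i
    ∑-single {suc n} f i f≡0 = begin
      ∑ f                        ≡⟨ Sum.sum-remove {i = i} f ⟩
      f i + ∑ (removeAt f i)     ≡⟨ cong (_+_ (f i)) (∑-cong λ j → f≡0 _ λ eq → punchInᵢ≢i i j (sym eq)) ⟩
      f i + ∑ {n} (λ _ → 0ℤ)     ≡⟨ cong (_+_ (f i)) (Sum.sum-replicate-zero n) ⟩
      f i + 0ℤ                   ≡⟨ ℤ.+-identityʳ _ ⟩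
      f i                        ∎
      where open ≡-Reasoning

  -- Sums over tuples of distinct vertices

  -- A value 0 carries no information: only lower bounds for the number of cycles
  -- are needed.
  data Bit (P : Set) : ℤ → Set where
    one : P → Bit P 1ℤ
    nil : Bit P 0ℤ

  Bit-map : ∀ {P Q : Set} {i} → (P → Q) → Bit P i → Bit Q i
  Bit-map f (one p) = one (f p)
  Bit-map f nil     = nil

  _Bit-×_ : ∀ {P Q : Set} {i j} → Bit P i → Bit Q j → Bit (P × Q) (i * j)
  one p Bit-× one q = one (p , q)
  one p Bit-× nil   = nil
  nil   Bit-× one q = nil
  nil   Bit-× nil   = nil

  Bit-idem : ∀ {P : Set} {i} → Bit P i → i * i ≡ i
  Bit-idem (one _) = refl
  Bit-idem nil     = refl

  -- A 0/1 integer rather than a proposition, so that distinctness can be a factor of a summand and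
  -- pass through sums.
  ne : Fin n → Fin n → ℤ
  ne a b with a ≟ b
  ... | yes _ = 0ℤ
  ... | no  _ = 1ℤ

  ne-Bit : (a b : Fin n) → Bit (a ≢ b) (ne a b)
  ne-Bit a b with a ≟ b
  ... | yes _  = nil
  ... | no a≢b = one a≢b

  ne-sym : (a b : Fin n) → ne a b ≡ ne b a
  ne-sym a b with a ≟ b | b ≟ a
  ... | yes _   | yes _   = refl
  ... | yes a≡b | no  b≢a = contradiction (sym a≡b) b≢a
  ... | no  a≢b | yes b≡a = contradiction (sym b≡a) a≢b
  ... | no  _   | no  _   = refl

  ne-refl : (a : Fin n) → ne a a ≡ 0ℤ
  ne-refl a with a ≟ a
  ... | yes _  = refl
  ... | no a≢a = contradiction refl a≢a

  ≢⇒ne≡1 : {a b : Fin n} → a ≢ b → ne a b ≡ 1ℤ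
  ≢⇒ne≡1 {a = a} {b} a≢b with a ≟ b
  ... | yes a≡b = contradiction a≡b a≢b
  ... | no  _   = refl

  -- Since `1 - ne a e` is the indicator of `a ≡ e`, the correction to the full sum is a sum with
  -- the single term `f a`.
  ∑-ne : (a : Fin n) (f : Fin n → ℤ) → ∑ (λ e → ne a e * f e) ≡ ∑ f - f a
  ∑-ne a f = begin
    ∑ (λ e → ne a e * f e)                     ≡⟨ ∑-cong (λ e → split (ne a e) (f e)) ⟩
    ∑ (λ e → f e + (- ((1ℤ - ne a e) * f e)))  ≡⟨ ∑-+ f _ ⟩
    ∑ f + ∑ (λ e → - ((1ℤ - ne a e) * f e))    ≡⟨ cong (_+_ (∑ f)) (∑-single _ a vanish) ⟩
    ∑ f - (1ℤ - ne a a) * f a                  ≡⟨ cong (λ i → ∑ f - (1ℤ - i) * f a) (ne-refl a) ⟩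
    ∑ f - 1ℤ * f a                             ≡⟨ cong (_-_ (∑ f)) (ℤ.*-identityˡ _) ⟩
    ∑ f - f a                                  ∎
    where
    open ≡-Reasoning
    split : ∀ i t → i * t ≡ t + (- ((1ℤ - i) * t))
    split = solve-∀
    vanish : ∀ e → a ≢ e → - ((1ℤ - ne a e) * f e) ≡ 0ℤ
    vanish e a≢e rewrite ≢⇒ne≡1 a≢e = refl

  apart : Fin n → List (Fin n) → ℤ
  apart e []      = 1ℤ
  apart e (a ∷ L) = ne a e * apart e L

  distinct : List (Fin n) → ℤ
  distinct []      = 1ℤ
  distinct (e ∷ L) = apart e L * distinct L

  apart-Bit : ∀ (e : Fin n) L → Bit (All (e ≢_) L) (apart e L)
  apart-Bit e []      = one []
  apart-Bit e (a ∷ L) = Bit-map (λ (a≢e , e∉L) → ≢-sym a≢e ∷ e∉L) (ne-Bit a e Bit-× apart-Bit e L)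

  distinct-Bit : (L : List (Fin n)) → Bit (AllPairs _≢_ L) (distinct L)
  distinct-Bit []      = one []
  distinct-Bit (e ∷ L) = Bit-map (uncurry _∷_) (apart-Bit e L Bit-× distinct-Bit L)

  *-swapˡ : ∀ i j t → i * (j * t) ≡ j * (i * t)
  *-swapˡ = solve-∀

  apart-↭ : ∀ (e : Fin n) {L L′} → L ↭ L′ → apart e L ≡ apart e L′
  apart-↭ e ↭.refl = refl
  apart-↭ e (↭.prep a p) = cong (ne a e *_) (apart-↭ e p)
  apart-↭ e (↭.swap a b p) = trans (*-swapˡ (ne a e) (ne b e) _) (cong (λ i → ne b e * (ne a e * i)) (apart-↭ e p))
  apart-↭ e (↭.trans p q) = trans (apart-↭ e p) (apart-↭ e q)

  distinct-↭ : ∀ {L L′ : List (Fin n)} → L ↭ L′ → distinct L ≡ distinct L′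
  distinct-↭ ↭.refl = refl
  distinct-↭ (↭.prep e p) = cong₂ _*_ (apart-↭ e p) (distinct-↭ p)
  distinct-↭ {L = _ ∷ _ ∷ L} {L′ = _ ∷ _ ∷ L′} (↭.swap a b p)
    rewrite apart-↭ a p | apart-↭ b p | distinct-↭ p | ne-sym b a = rearrange (ne a b) (apart a L′) (apart b L′) (distinct L′)
    where
    rearrange : ∀ i s t d → i * s * (t * d) ≡ i * t * (s * d)
    rearrange = solve-∀
  distinct-↭ (↭.trans p q) = trans (distinct-↭ p) (distinct-↭ q)

  sumOver : List (Fin n) → (Fin n → ℤ) → ℤ
  sumOver L f = foldr (λ a s → f a + s) 0ℤ L

  -- If `L` had a repetition, `sumOver` would subtract a value twice; the factor `distinct L`
  -- annihilates that case. Peeling `a` off `L` leaves a second factor `apart a L`, which is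
  -- absorbed because a bit is idempotent.
  ∑-apart : ∀ L (f : Fin n → ℤ) → distinct L * ∑ (λ e → apart e L * f e) ≡ distinct L * (∑ f - sumOver L f)
  ∑-apart []      f = cong (1ℤ *_) (trans (∑-cong λ e → ℤ.*-identityˡ (f e)) (sym (ℤ.+-identityʳ _)))
  ∑-apart (a ∷ L) f = begin
    m * D * ∑ (λ e → ne a e * apart e L * f e)
      ≡⟨ cong (m * D *_) (trans (∑-cong λ e → ℤ.*-assoc (ne a e) (apart e L) (f e)) (∑-ne a _)) ⟩
    m * D * (∑ (λ e → apart e L * f e) - m * f a)
      ≡⟨ expand m D _ (f a) ⟩
    m * (D * ∑ (λ e → apart e L * f e)) - m * m * (D * f a)
      ≡⟨ cong₂ (λ i j → m * i - j * (D * f a)) (∑-apart L f) (Bit-idem (apart-Bit a L)) ⟩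
    m * (D * (∑ f - sumOver L f)) - m * (D * f a)
      ≡⟨ collect m D (∑ f) (sumOver L f) (f a) ⟩
    m * D * (∑ f - (f a + sumOver L f)) ∎
    where
    open ≡-Reasoning
    m = apart a L
    D = distinct L
    expand : ∀ m D s t → m * D * (s - m * t) ≡ m * (D * s) - m * m * (D * t)
    expand = solve-∀
    collect : ∀ m D s u t → m * (D * (s - u)) - m * (D * t) ≡ m * D * (s - (t + u))
    collect = solve-∀

  -- Curried, so that summands are plain lambdas and fixing the first vertex is mere application.
  Fun : ℕ → ℕ → Set
  Fun n zero    = ℤ
  Fun n (suc k) = Fin n → Fun n k

  -- The sum of F over the k-tuples whose entries are distinct from each other and
  -- from those of L (0 if L has a repetition); L lists the entries chosen so far,
  -- the latest one first.
  ∑≢ : ∀ k → List (Fin n) → Fun n k → ℤ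
  ∑≢ zero    L c = distinct L * c
  ∑≢ (suc k) L F = ∑ λ a → ∑≢ k (a ∷ L) (F a)

  -- The relation is demanded only on tuples without repetition. The inequalities of
  -- `AllPairs _≢_ L` are what later allows squares of signs to be replaced by 1.
  On≢ : (ℤ → ℤ → Set) → ∀ k → List (Fin n) → Fun n k → Fun n k → Set
  On≢ _~_ zero    L c d = AllPairs _≢_ L → c ~ d
  On≢ _~_ (suc k) L F G = ∀ a → On≢ _~_ k (a ∷ L) (F a) (G a)

  ∑≢-cong : ∀ k L {F G : Fun n k} → On≢ _≡_ k L F G → ∑≢ k L F ≡ ∑≢ k L G
  ∑≢-cong zero L {c} {d} c≡d with distinct L | distinct-Bit L
  ... | _ | one L! = cong (1ℤ *_) (c≡d L!)
  ... | _ | nil    = trans (ℤ.*-zeroˡ c) (sym (ℤ.*-zeroˡ d))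
  ∑≢-cong (suc k) L F≡G = ∑-cong λ a → ∑≢-cong k (a ∷ L) (F≡G a)

  ∑≢-mono : ∀ k L {F G : Fun n k} → On≢ _≤_ k L F G → ∑≢ k L F ≤ ∑≢ k L G
  ∑≢-mono zero L {c} {d} c≤d with distinct L | distinct-Bit L
  ... | _ | one L! = ℤ.*-monoˡ-≤-nonNeg 1ℤ (c≤d L!)
  ... | _ | nil    = ℤ.≤-reflexive (trans (ℤ.*-zeroˡ c) (sym (ℤ.*-zeroˡ d)))
  ∑≢-mono (suc k) L F≤G = ∑-mono λ a → ∑≢-mono k (a ∷ L) (F≤G a)

  infixl 6 _⊕_
  infixl 7 _⊛_

  _⊕_ : Fun n k → Fun n k → Fun n k
  _⊕_ {k = zero}  c d = c + d
  _⊕_ {k = suc k} F G = λ a → F a ⊕ G a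

  _⊛_ : ℤ → Fun n k → Fun n k
  _⊛_ {k = zero}  c d = c * d
  _⊛_ {k = suc k} c F = λ a → c ⊛ F a

  ∑≢-⊕ : ∀ k L (F G : Fun n k) → ∑≢ k L (F ⊕ G) ≡ ∑≢ k L F + ∑≢ k L G
  ∑≢-⊕ zero    L c d = ℤ.*-distribˡ-+ (distinct L) c d
  ∑≢-⊕ (suc k) L F G = trans (∑-cong λ a → ∑≢-⊕ k (a ∷ L) (F a) (G a)) (∑-+ _ _)

  ∑≢-⊛ : ∀ k L c (F : Fun n k) → ∑≢ k L (c ⊛ F) ≡ c * ∑≢ k L F
  ∑≢-⊛ zero    L c d = *-swapˡ (distinct L) c d
  ∑≢-⊛ (suc k) L c F = trans (∑-cong λ a → ∑≢-⊛ k (a ∷ L) c (F a)) (∑-* c _)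

  ∑≢-↭ : ∀ k {L L′} → L ↭ L′ → (F : Fun n k) → ∑≢ k L F ≡ ∑≢ k L′ F
  ∑≢-↭ zero    p c = cong (_* c) (distinct-↭ p)
  ∑≢-↭ (suc k) p F = ∑-cong λ a → ∑≢-↭ k (↭.prep a p) (F a)

  -- Exchanging the two outer summations permutes the list of chosen vertices, and `∑≢` does not
  -- depend on the order of that list.
  ∑≢-swap : ∀ k L (F : Fun n (2 ℕ.+ k)) → ∑≢ (2 ℕ.+ k) L F ≡ ∑≢ (2 ℕ.+ k) L (λ a b → F b a)
  ∑≢-swap k L F = trans (∑-comm _) (∑-cong λ b → ∑-cong λ a → ∑≢-↭ k (↭.swap b a ↭.refl) (F a b))

  -- The first argument of `F` becomes the last one of the result. This is a cyclic rotation of the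
  -- arguments; it also brings the first vertex to the place where `∑≢-last` can sum it out.
  moveLast : ∀ k → (Fin n → Fun n k) → Fun n (suc k)
  moveLast zero    F = F
  moveLast (suc k) F = λ b → moveLast k λ a → F a b

  ∑≢-moveLast : ∀ k L (F : Fun n (suc k)) → ∑≢ (suc k) L F ≡ ∑≢ (suc k) L (moveLast k F)
  ∑≢-moveLast zero    L F = refl
  ∑≢-moveLast (suc k) L F = trans (∑≢-swap k L F) (∑-cong λ b → ∑≢-moveLast k (b ∷ L) λ a → F a b)

  reverseArgs : ∀ k → Fun n k → Fun n k
  reverseArgs zero    c = c
  reverseArgs (suc k) F = moveLast k λ a → reverseArgs k (F a)

  ∑≢-reverse : ∀ k L (F : Fun n k) → ∑≢ k L F ≡ ∑≢ k L (reverseArgs k F)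
  ∑≢-reverse zero    L c = refl
  ∑≢-reverse (suc k) L F = trans (∑-cong λ a → ∑≢-reverse k (a ∷ L) (F a)) (∑≢-moveLast k L _)

  -- The last vertex runs over all vertices except those already chosen.
  sumLast : ∀ k → List (Fin n) → Fun n (suc k) → Fun n k
  sumLast zero    L F = ∑ F - sumOver L F
  sumLast (suc k) L F = λ a → sumLast k (a ∷ L) (F a)

  ∑≢-last : ∀ k L (F : Fun n (suc k)) → ∑≢ (suc k) L F ≡ ∑≢ k L (sumLast k L F)
  ∑≢-last zero L F = begin
    ∑ (λ e → apart e L * distinct L * F e)     ≡⟨ ∑-cong (λ e → rearrange (apart e L) (distinct L) (F e)) ⟩
    ∑ (λ e → distinct L * (apart e L * F e))   ≡⟨ ∑-* (distinct L) _ ⟩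
    distinct L * ∑ (λ e → apart e L * F e)     ≡⟨ ∑-apart L F ⟩
    distinct L * (∑ F - sumOver L F)           ∎
    where
    open ≡-Reasoning
    rearrange : ∀ m d t → m * d * t ≡ d * (m * t)
    rearrange = solve-∀
  ∑≢-last (suc k) L F = ∑-cong λ a → ∑≢-last k (a ∷ L) (F a)

  pad : ∀ k → Fun n k → Fun n (suc k)
  pad zero    c = λ _ → c
  pad (suc k) F = λ a → pad k (F a)

  sumOver-const : ∀ (L : List (Fin n)) c → sumOver L (λ _ → c) ≡ + length L * c
  sumOver-const []      c = sym (ℤ.*-zeroˡ c)
  sumOver-const (_ ∷ L) c = trans (cong (_+_ c) (sumOver-const L c)) (sym (ℤ.suc-* (+ length L) c))

  -- A last vertex that the summand ignores can be any vertex outside the `k + length L` distinct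
  -- ones already chosen, which gives the factor.
  ∑≢-pad : ∀ k (L : List (Fin n)) (F : Fun n k) → ∑≢ (suc k) L (pad k F) ≡ (+ n - + (k ℕ.+ length L)) * ∑≢ k L F
  ∑≢-pad {n} zero L c = begin
    ∑≢ 1 L (λ _ → c)                                      ≡⟨ ∑≢-last zero L _ ⟩
    distinct L * (∑ {n} (λ _ → c) - sumOver L (λ _ → c))  ≡⟨ cong₂ (λ i j → distinct L * (i - j)) (∑-const n c) (sumOver-const L c) ⟩
    distinct L * (+ n * c - + length L * c)               ≡⟨ rearrange (distinct L) (+ n) (+ length L) c ⟩
    (+ n - + length L) * (distinct L * c)                 ∎
    where
    open ≡-Reasoning
    rearrange : ∀ d i j c → d * (i * c - j * c) ≡ (i - j) * (d * c)
    rearrange = solve-∀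
  ∑≢-pad {n} (suc k) L F = trans
    (∑-cong λ a → trans (∑≢-pad k (a ∷ L) (F a)) (cong (λ m → (+ n - + m) * ∑≢ k (a ∷ L) (F a)) (ℕ.+-suc k (length L))))
    (∑-* (+ n - + suc (k ℕ.+ length L)) _)

  -- Path sums of a skew matrix of signs

  self-negative : ∀ {i} → i ≡ - i → i ≡ 0ℤ
  self-negative {+ 0}          _  = refl
  self-negative {ℤ.+[1+ _ ]} ()
  self-negative {ℤ.-[1+ _ ]} ()

  square-nonneg : ∀ i → 0ℤ ≤ i * i
  square-nonneg (+ 0)        = ℤ.≤-refl
  square-nonneg ℤ.+[1+ _ ] = +≤+ z≤n
  square-nonneg ℤ.-[1+ _ ] = +≤+ z≤n

  ∑-nonneg : {f : Fin n → ℤ} → (∀ i → 0ℤ ≤ f i) → 0ℤ ≤ ∑ f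
  ∑-nonneg {n} {f} f≥0 = begin
    0ℤ               ≡⟨ ℤ.*-zeroʳ (+ n) ⟨
    + n * 0ℤ         ≡⟨ ∑-const n 0ℤ ⟨
    ∑ {n} (λ _ → 0ℤ) ≤⟨ ∑-mono f≥0 ⟩
    ∑ f              ∎
    where open ℤ.≤-Reasoning

  Unit : ℤ → Set
  Unit i = i ≡ 1ℤ ⊎ i ≡ -1ℤ

  Unit-* : ∀ {i j} → Unit i → Unit j → Unit (i * j)
  Unit-* (inj₁ refl) (inj₁ refl) = inj₁ refl
  Unit-* (inj₁ refl) (inj₂ refl) = inj₂ refl
  Unit-* (inj₂ refl) (inj₁ refl) = inj₂ refl
  Unit-* (inj₂ refl) (inj₂ refl) = inj₁ refl

  Unit⇒≤1 : ∀ {i} → Unit i → i ≤ 1ℤ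
  Unit⇒≤1 (inj₁ refl) = ℤ.≤-refl
  Unit⇒≤1 (inj₂ refl) = -≤+

  Unit⇒square : ∀ {i} → Unit i → i * i ≡ 1ℤ
  Unit⇒square (inj₁ refl) = refl
  Unit⇒square (inj₂ refl) = refl

  *-nonneg : ∀ {i j} → 0ℤ ≤ i → 0ℤ ≤ j → 0ℤ ≤ i * j
  *-nonneg {+ m} {+ n} _ _ = subst (0ℤ ≤_) (ℤ.pos-* m n) (+≤+ z≤n)

  ∑≢₁ : (f : Fin n → ℤ) → ∑≢ 1 [] f ≡ ∑ f
  ∑≢₁ f = ∑-cong λ a → ℤ.*-identityˡ (f a)

  -- A sum equal to its own negative vanishes. The hypothesis will come from relabellings that
  -- change an odd number of skew factors.
  ∑≢-odd : ∀ k (F : Fun n k) → ∑≢ k [] F ≡ ∑≢ k [] (-1ℤ ⊛ F) → ∑≢ k [] F ≡ 0ℤ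
  ∑≢-odd k F F≡-F = self-negative (trans F≡-F (trans (∑≢-⊛ k [] -1ℤ F) (ℤ.-1*i≡-i (∑≢ k [] F))))

  module SignMatrix {n : ℕ} (x : Fin n → Fin n → ℤ)
    (skew : ∀ a b → x b a ≡ - x a b) (unit : ∀ {a b} → a ≢ b → Unit (x a b)) where

    r : Fin n → ℤ
    r a = ∑ (x a)

    R : ℤ
    R = ∑ λ a → r a * r a

    -- With `r` = A 1 for the matrix A of `x`, this is the vector A² 1.
    q : Fin n → ℤ
    q a = ∑ λ b → x a b * r b

    infix 8 n-_

    -- An integer difference, negative when `n` is below `m`, so that polynomial identities hold for
    -- every `n`.
    n-_ : ℕ → ℤ
    n- m = + n - + m

    diag : ∀ a → x a a ≡ 0ℤ
    diag a = self-negative (skew a a)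

    ∑-column : ∀ b → ∑ (λ a → x a b) ≡ - r b
    ∑-column b = begin
      ∑ (λ a → x a b)           ≡⟨ ∑-cong (λ a → trans (skew b a) (sym (ℤ.-1*i≡-i (x b a)))) ⟩
      ∑ (λ a → -1ℤ * x b a)     ≡⟨ ∑-* -1ℤ (x b) ⟩
      -1ℤ * r b                 ≡⟨ ℤ.-1*i≡-i (r b) ⟩
      - r b                     ∎
      where open ≡-Reasoning

    ∑≢-ones₂ : ∑≢ {n} 2 [] (λ _ _ → 1ℤ) ≡ n- 0 * n- 1
    ∑≢-ones₂ = trans (∑≢-pad {n} 1 [] λ _ → 1ℤ) (trans (cong (n- 1 *_) (∑≢-pad {n} 0 [] 1ℤ)) (rearrange (n- 0) (n- 1)))
      where
      rearrange : ∀ i j → j * (i * 1ℤ) ≡ i * j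
      rearrange = solve-∀

    ∑≢-ones₄ : ∑≢ {n} 4 [] (λ _ _ _ _ → 1ℤ) ≡ n- 0 * n- 1 * n- 2 * n- 3
    ∑≢-ones₄ = trans (∑≢-pad {n} 3 [] λ _ _ _ → 1ℤ) (trans (cong (n- 3 *_) (trans (∑≢-pad {n} 2 [] λ _ _ → 1ℤ)
      (cong (n- 2 *_) ∑≢-ones₂))) (rearrange (n- 0) (n- 1) (n- 2) (n- 3)))
      where
      rearrange : ∀ i j k l → l * (k * (i * j)) ≡ i * j * k * l
      rearrange = solve-∀

    ∑≢-ones₅ : ∑≢ {n} 5 [] (λ _ _ _ _ _ → 1ℤ) ≡ n- 0 * n- 1 * n- 2 * n- 3 * n- 4
    ∑≢-ones₅ = trans (∑≢-pad {n} 4 [] λ _ _ _ _ → 1ℤ) (trans (cong (n- 4 *_) ∑≢-ones₄) (ℤ.*-comm (n- 4) _))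

    P₂ : ℤ
    P₂ = ∑≢ 3 [] λ a b c → x a b * x b c

    -- The sum is the inner product of the column sums with the row sums, and by skewness column
    -- sums are negated row sums.
    ∑q≡-R : ∑ q ≡ - R
    ∑q≡-R = begin
      ∑ (λ a → ∑ λ b → x a b * r b)        ≡⟨ ∑-comm (λ a b → x a b * r b) ⟩
      ∑ (λ b → ∑ λ a → x a b * r b)        ≡⟨ ∑-cong (λ b → trans (∑-cong λ a → ℤ.*-comm (x a b) (r b)) (∑-* (r b) _)) ⟩
      ∑ (λ b → r b * ∑ λ a → x a b)        ≡⟨ ∑-cong (λ b → trans (cong (r b *_) (∑-column b)) (move (r b))) ⟩
      ∑ (λ b → -1ℤ * (r b * r b))          ≡⟨ ∑-* -1ℤ _ ⟩
      -1ℤ * R                              ≡⟨ ℤ.-1*i≡-i R ⟩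
      - R                                  ∎
      where
      open ≡-Reasoning
      move : ∀ i → i * - i ≡ -1ℤ * (i * i)
      move = solve-∀

    ∑≢-edge-end : ∑≢ 2 [] (λ a b → x a b * r b) ≡ - R
    ∑≢-edge-end = begin
      ∑≢ 2 [] (λ a b → x a b * r b)   ≡⟨ ∑≢-last 1 [] _ ⟩
      ∑≢ 1 [] (λ a → q a - (x a a * r a + 0ℤ))
        ≡⟨ ∑≢-cong 1 [] (λ a _ → trans (cong (λ i → q a - (i * r a + 0ℤ)) (diag a)) (simp (q a) (r a))) ⟩
      ∑≢ 1 [] q                       ≡⟨ ∑≢₁ q ⟩
      ∑ q                             ≡⟨ ∑q≡-R ⟩
      - R                             ∎
      where
      open ≡-Reasoning
      simp : ∀ i j → i - (0ℤ * j + 0ℤ) ≡ i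
      simp = solve-∀

    -- The end `c` is summed out. Its free sum gives `r b`; the excluded value `c = b` is a zero
    -- diagonal entry, and `c = a` gives `- x a b * x a b`, so removing it adds 1 for each ordered
    -- pair.
    P₂≡ : P₂ ≡ n- 0 * n- 1 - R
    P₂≡ = begin
      P₂ ≡⟨ ∑≢-last 2 [] _ ⟩
      ∑≢ 2 [] (λ a b → ∑ (λ c → x a b * x b c) - (x a b * x b b + (x a b * x b a + 0ℤ)))
        ≡⟨ ∑≢-cong 2 [] step ⟩
      ∑≢ 2 [] ((λ a b → x a b * r b) ⊕ (λ _ _ → 1ℤ))
        ≡⟨ ∑≢-⊕ 2 [] (λ a b → x a b * r b) _ ⟩
      ∑≢ 2 [] (λ a b → x a b * r b) + ∑≢ {n} 2 [] (λ _ _ → 1ℤ)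
        ≡⟨ cong₂ _+_ ∑≢-edge-end ∑≢-ones₂ ⟩
      - R + n- 0 * n- 1 ≡⟨ ℤ.+-comm (- R) _ ⟩
      n- 0 * n- 1 - R ∎
      where
      open ≡-Reasoning
      simp : ∀ i s → i * s - (i * 0ℤ + (i * - i + 0ℤ)) ≡ i * s + i * i
      simp = solve-∀
      step : On≢ _≡_ 2 [] (λ a b → ∑ (λ c → x a b * x b c) - (x a b * x b b + (x a b * x b a + 0ℤ)))
                          ((λ a b → x a b * r b) ⊕ (λ _ _ → 1ℤ))
      step a b ((b≢a ∷ []) ∷ _) rewrite diag b | skew a b | ∑-* (x a b) (x b) =
        trans (simp (x a b) (r b)) (cong (_+_ (x a b * r b)) (Unit⇒square (unit (≢-sym b≢a))))

    -- The squared norm of A² 1. By skewness it is also the entry sum of A⁴, that is, the signed sum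
    -- over all four-edge walks, with repetitions allowed.
    W₄ : ℤ
    W₄ = ∑ λ a → q a * q a

    -- The correction in `P₄≡` for paths whose fifth vertex would return to the first.
    Q₄ : ℤ
    Q₄ = ∑≢ 4 [] λ a b c d → x a b * x b c * x c d * x d a

    P₄ : ℤ
    P₄ = ∑≢ 5 [] λ a b c d e → x a b * x b c * x c d * x d e

    -- Σ over b, c, d without distinctness is − W₄ by skewness; R corrects for b = d.
    weighted-P₂ : ∑≢ 3 [] (λ b c d → r b * x b c * x c d * r d) ≡ n- 1 * R - W₄
    weighted-P₂ = begin
      ∑≢ 3 [] (λ b c d → r b * x b c * x c d * r d)
        ≡⟨ ∑≢-last 2 [] _ ⟩
      ∑≢ 2 [] (λ b c → ∑ (λ d → r b * x b c * x c d * r d)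
                       - (r b * x b c * x c c * r c + (r b * x b c * x c b * r b + 0ℤ)))
        ≡⟨ ∑≢-cong 2 [] step ⟩
      ∑≢ 2 [] ((λ b c → r b * x b c * q c) ⊕ (λ b _ → r b * r b))
        ≡⟨ ∑≢-⊕ 2 [] (λ b c → r b * x b c * q c) _ ⟩
      ∑≢ 2 [] (λ b c → r b * x b c * q c) + ∑≢ 2 [] (λ b _ → r b * r b)
        ≡⟨ cong₂ _+_ square (trans (∑≢-pad 1 [] λ b → r b * r b) (cong (n- 1 *_) (∑≢₁ _))) ⟩
      - W₄ + n- 1 * R ≡⟨ ℤ.+-comm (- W₄) _ ⟩
      n- 1 * R - W₄ ∎
      where
      open ≡-Reasoning
      simp : ∀ i j s t → i * j * s - (i * j * 0ℤ * t + (i * j * - j * i + 0ℤ)) ≡ i * j * s + i * i * (j * j)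
      simp = solve-∀
      step : On≢ _≡_ 2 [] (λ b c → ∑ (λ d → r b * x b c * x c d * r d)
                                  - (r b * x b c * x c c * r c + (r b * x b c * x c b * r b + 0ℤ)))
                         ((λ b c → r b * x b c * q c) ⊕ (λ b _ → r b * r b))
      step b c ((c≢b ∷ []) ∷ _)
        rewrite diag c | skew b c
              | ∑-cong (λ d → ℤ.*-assoc (r b * x b c) (x c d) (r d)) | ∑-* (r b * x b c) (λ d → x c d * r d) =
        trans (simp (r b) (x b c) (q c) (r c))
              (cong (_+_ (r b * x b c * q c)) (trans (cong (r b * r b *_) (Unit⇒square (unit (≢-sym c≢b)))) (ℤ.*-identityʳ _)))
      collect : ∀ i → - i * i ≡ -1ℤ * (i * i)
      collect = solve-∀
      square : ∑≢ 2 [] (λ b c → r b * x b c * q c) ≡ - W₄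
      square = begin
        ∑≢ 2 [] (λ b c → r b * x b c * q c)
          ≡⟨ ∑≢-last 1 [] _ ⟩
        ∑≢ 1 [] (λ b → ∑ (λ c → r b * x b c * q c) - (r b * x b b * q b + 0ℤ))
          ≡⟨ ∑≢-cong 1 [] (λ b _ → trans (cong (λ i → ∑ (λ c → r b * x b c * q c) - (r b * i * q b + 0ℤ)) (diag b)) (drop (∑ λ c → r b * x b c * q c) (r b) (q b))) ⟩
        ∑≢ 1 [] (λ b → ∑ (λ c → r b * x b c * q c))
          ≡⟨ ∑≢₁ _ ⟩
        ∑ (λ b → ∑ λ c → r b * x b c * q c)
          ≡⟨ ∑-comm (λ b c → r b * x b c * q c) ⟩
        ∑ (λ c → ∑ λ b → r b * x b c * q c)
          ≡⟨ ∑-cong (λ c → trans (∑-cong λ b → trans (cong (λ i → r b * i * q c) (skew c b)) (flip (r b) (x c b) (q c)))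
                                 (∑-* (- q c) (λ b → x c b * r b))) ⟩
        ∑ (λ c → - q c * q c)
          ≡⟨ ∑-cong (λ c → collect (q c)) ⟩
        ∑ (λ c → -1ℤ * (q c * q c)) ≡⟨ ∑-* -1ℤ _ ⟩
        -1ℤ * W₄ ≡⟨ ℤ.-1*i≡-i W₄ ⟩
        - W₄ ∎
        where
        drop : ∀ s i k → s - (i * 0ℤ * k + 0ℤ) ≡ s
        drop = solve-∀
        flip : ∀ i j k → i * - j * k ≡ - k * (j * i)
        flip = solve-∀

    -- The first vertex `a` is summed out. Its free sum `- r b` leads to `weighted-P₂`; the excluded
    -- value `a = d` closes a triangle, whose sum is odd; `a = c` repeats an edge, whose squared
    -- sign is 1; `a = b` gives 0.
    weighted-P₃ : ∑≢ 4 [] (λ a b c d → x a b * x b c * x c d * r d) ≡ W₄ - n- 1 * R - n- 2 * R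
    weighted-P₃ = begin
      ∑≢ 4 [] (λ a b c d → x a b * x b c * x c d * r d)
        ≡⟨ ∑≢-moveLast 3 [] _ ⟩
      ∑≢ 4 [] (λ b c d a → x a b * x b c * x c d * r d)
        ≡⟨ ∑≢-last 3 [] _ ⟩
      ∑≢ 3 [] (λ b c d → ∑ (λ a → x a b * x b c * x c d * r d)
        - (x d b * x b c * x c d * r d + (x c b * x b c * x c d * r d + (x b b * x b c * x c d * r d + 0ℤ))))
        ≡⟨ ∑≢-cong 3 [] step ⟩
      ∑≢ 3 [] (-1ℤ ⊛ F₁ ⊕ -1ℤ ⊛ F₂ ⊕ F₃)
        ≡⟨ trans (∑≢-⊕ 3 [] (-1ℤ ⊛ F₁ ⊕ -1ℤ ⊛ F₂) F₃)
                 (cong (_+ ∑≢ 3 [] F₃) (trans (∑≢-⊕ 3 [] (-1ℤ ⊛ F₁) (-1ℤ ⊛ F₂))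
                                              (cong₂ _+_ (∑≢-⊛ 3 [] -1ℤ F₁) (∑≢-⊛ 3 [] -1ℤ F₂)))) ⟩
      -1ℤ * ∑≢ 3 [] F₁ + -1ℤ * ∑≢ 3 [] F₂ + ∑≢ 3 [] F₃
        ≡⟨ cong₂ _+_ (cong₂ (λ i j → -1ℤ * i + -1ℤ * j) weighted-P₂ F₂-odd) F₃≡ ⟩
      -1ℤ * (n- 1 * R - W₄) + -1ℤ * 0ℤ + n- 2 * - R
        ≡⟨ collect (n- 1) (n- 2) R W₄ ⟩
      W₄ - n- 1 * R - n- 2 * R ∎
      where
      open ≡-Reasoning
      F₁ F₂ F₃ : Fun n 3
      F₁ b c d = r b * x b c * x c d * r d
      F₂ b c d = x d b * x b c * x c d * r d
      F₃ b c d = x c d * r d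
      collect : ∀ i j s w → -1ℤ * (i * s - w) + -1ℤ * 0ℤ + j * - s ≡ w - i * s - j * s
      collect = solve-∀
      simp : ∀ i y u v w t → - i * u * v * t - (y * u * v * t + (- u * u * v * t + (0ℤ * u * v * t + 0ℤ)))
                         ≡ -1ℤ * (i * u * v * t) + -1ℤ * (y * u * v * t) + u * u * (v * t)
      simp = solve-∀
      pull : ∀ i u v t → i * u * v * t ≡ u * v * t * i
      pull = solve-∀
      sum-a : ∀ b c d → ∑ (λ a → x a b * x b c * x c d * r d) ≡ - r b * x b c * x c d * r d
      sum-a b c d = begin
        ∑ (λ a → x a b * x b c * x c d * r d)    ≡⟨ ∑-cong (λ a → pull (x a b) (x b c) (x c d) (r d)) ⟩
        ∑ (λ a → x b c * x c d * r d * x a b)    ≡⟨ ∑-* (x b c * x c d * r d) _ ⟩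
        x b c * x c d * r d * ∑ (λ a → x a b)    ≡⟨ cong (x b c * x c d * r d *_) (∑-column b) ⟩
        x b c * x c d * r d * - r b              ≡⟨ pull (- r b) (x b c) (x c d) (r d) ⟨
        - r b * x b c * x c d * r d              ∎
      step : On≢ _≡_ 3 [] (λ b c d → ∑ (λ a → x a b * x b c * x c d * r d)
        - (x d b * x b c * x c d * r d + (x c b * x b c * x c d * r d + (x b b * x b c * x c d * r d + 0ℤ))))
        (-1ℤ ⊛ F₁ ⊕ -1ℤ ⊛ F₂ ⊕ F₃)
      step b c d (_ ∷ (c≢b ∷ []) ∷ _) rewrite sum-a b c d | diag b | skew b c =
        trans (simp (r b) (x d b) (x b c) (x c d) 0ℤ (r d))
              (cong (_+_ (-1ℤ * F₁ b c d + -1ℤ * F₂ b c d)) (trans (cong (_* (x c d * r d)) (Unit⇒square (unit (≢-sym c≢b)))) (ℤ.*-identityˡ _)))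
      -- Exchanging `b` and `c` reverses the triangle, which changes three signs and keeps the
      -- weight `r d`.
      F₂-odd : ∑≢ 3 [] F₂ ≡ 0ℤ
      F₂-odd = ∑≢-odd 3 F₂ (trans (∑≢-swap 1 [] F₂) (∑≢-cong 3 [] λ b c d _ → flip b c d))
        where
        neg : ∀ i j k t → - i * - j * - k * t ≡ -1ℤ * (k * j * i * t)
        neg = solve-∀
        flip : ∀ b c d → F₂ c b d ≡ -1ℤ * F₂ b c d
        flip b c d rewrite skew c d | skew b c | skew d b = neg (x c d) (x b c) (x d b) (r d)
      F₃≡ : ∑≢ 3 [] F₃ ≡ n- 2 * - R
      F₃≡ = trans (∑≢-moveLast 2 [] F₃) (trans (∑≢-pad 2 [] λ c d → x c d * r d) (cong (n- 2 *_) ∑≢-edge-end))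

    -- The end `e` is summed out. Its free sum is `r d`; the excluded value `e = d` gives 0, `e = c`
    -- squares the last edge and leaves a two-edge path with `d` arbitrary, `e = b` closes a
    -- triangle with a tail, and `e = a` gives `Q₄`.
    P₄≡ : P₄ ≡ W₄ - n- 1 * R - n- 2 * R + n- 3 * P₂ - Q₄
    P₄≡ = begin
      P₄ ≡⟨ ∑≢-last 4 [] _ ⟩
      ∑≢ 4 [] (sumLast 4 [] λ a b c d e → x a b * x b c * x c d * x d e)
        ≡⟨ ∑≢-cong 4 [] step ⟩
      ∑≢ 4 [] (F₁ ⊕ F₂ ⊕ -1ℤ ⊛ F₃ ⊕ -1ℤ ⊛ F₄)
        ≡⟨ trans (∑≢-⊕ 4 [] (F₁ ⊕ F₂ ⊕ -1ℤ ⊛ F₃) (-1ℤ ⊛ F₄)) (cong₂ _+_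
             (trans (∑≢-⊕ 4 [] (F₁ ⊕ F₂) (-1ℤ ⊛ F₃)) (cong₂ _+_ (∑≢-⊕ 4 [] F₁ F₂) (∑≢-⊛ 4 [] -1ℤ F₃)))
             (∑≢-⊛ 4 [] -1ℤ F₄)) ⟩
      ∑≢ 4 [] F₁ + ∑≢ 4 [] F₂ + -1ℤ * ∑≢ 4 [] F₃ + -1ℤ * Q₄
        ≡⟨ cong₂ (λ i j → i + -1ℤ * j + -1ℤ * Q₄) (cong₂ _+_ weighted-P₃ (∑≢-pad 3 [] λ a b c → x a b * x b c)) F₃-odd ⟩
      W₄ - n- 1 * R - n- 2 * R + n- 3 * P₂ + -1ℤ * 0ℤ + -1ℤ * Q₄
        ≡⟨ simp′ (W₄ - n- 1 * R - n- 2 * R + n- 3 * P₂) Q₄ ⟩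
      W₄ - n- 1 * R - n- 2 * R + n- 3 * P₂ - Q₄ ∎
      where
      open ≡-Reasoning
      F₁ F₂ F₃ F₄ : Fun n 4
      F₁ a b c d = x a b * x b c * x c d * r d
      F₂ a b c d = x a b * x b c
      F₃ a b c d = x a b * x b c * x c d * x d b
      F₄ a b c d = x a b * x b c * x c d * x d a
      simp′ : ∀ i j → i + -1ℤ * 0ℤ + -1ℤ * j ≡ i - j
      simp′ = solve-∀
      simp : ∀ i j k s t u → i * j * k * s - (i * j * k * 0ℤ + (i * j * k * - k + (i * j * k * t + (i * j * k * u + 0ℤ))))
                         ≡ i * j * k * s + k * k * (i * j) + -1ℤ * (i * j * k * t) + -1ℤ * (i * j * k * u)
      simp = solve-∀
      step : On≢ _≡_ 4 [] (sumLast 4 [] λ a b c d e → x a b * x b c * x c d * x d e) (F₁ ⊕ F₂ ⊕ -1ℤ ⊛ F₃ ⊕ -1ℤ ⊛ F₄)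
      step a b c d ((d≢c ∷ _) ∷ _) rewrite ∑-* (x a b * x b c * x c d) (x d) | diag d | skew c d =
        trans (simp (x a b) (x b c) (x c d) (r d) (x d b) (x d a))
              (cong (λ i → F₁ a b c d + i + -1ℤ * F₃ a b c d + -1ℤ * F₄ a b c d)
                    (trans (cong (_* (x a b * x b c)) (Unit⇒square (unit (≢-sym d≢c)))) (ℤ.*-identityˡ _)))
      -- Exchanging `c` and `d` reverses the triangle on `b`, `c`, `d` and leaves the tail from `a`
      -- to `b` alone.
      F₃-odd : ∑≢ 4 [] F₃ ≡ 0ℤ
      F₃-odd = ∑≢-odd 4 F₃ (trans (∑-cong λ a → ∑-cong λ b → ∑≢-swap 0 (b ∷ a ∷ []) (F₃ a b))
                                  (∑≢-cong 4 [] λ a b c d _ → flip a b c d))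
        where
        neg : ∀ y i j k → y * - i * - j * - k ≡ -1ℤ * (y * k * j * i)
        neg = solve-∀
        flip : ∀ a b c d → F₃ a b d c ≡ -1ℤ * F₃ a b c d
        flip a b c d rewrite skew d b | skew c d | skew b c = neg (x a b) (x d b) (x c d) (x b c)

    Q₄≤ : Q₄ ≤ n- 0 * n- 1 * n- 2 * n- 3
    Q₄≤ = ℤ.≤-trans (∑≢-mono 4 [] bound) (ℤ.≤-reflexive ∑≢-ones₄)
      where
      bound : On≢ _≤_ 4 [] (λ a b c d → x a b * x b c * x c d * x d a) (λ _ _ _ _ → 1ℤ)
      bound a b c d ((d≢c ∷ _ ∷ d≢a ∷ []) ∷ (c≢b ∷ _) ∷ (b≢a ∷ _) ∷ _) = Unit⇒≤1
        (Unit-* (Unit-* (Unit-* (unit (≢-sym b≢a)) (unit (≢-sym c≢b))) (unit (≢-sym d≢c))) (unit d≢a))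

    -- 32 times the number of directed closed 5-tuples.
    cycleSum : ℤ
    cycleSum = ∑≢ 5 [] λ a b c d e → (1ℤ + x a b) * (1ℤ + x b c) * (1ℤ + x c d) * (1ℤ + x d e) * (1ℤ + x e a)

    -- Doubling pairs each tuple with its reversal, in which all five signs are negated: odd
    -- monomials cancel and even ones appear twice. The five rotations of `K` have equal sums, hence
    -- the factor 5.
    cycleSum≡ : cycleSum ≡ n- 0 * n- 1 * n- 2 * n- 3 * n- 4 + + 5 * (n- 4 * (n- 3 * P₂) + P₄)
    cycleSum≡ = ℤ.*-cancelˡ-≡ (+ 2) _ _ (begin
      + 2 * cycleSum                        ≡⟨ double cycleSum ⟩
      cycleSum + cycleSum                   ≡⟨ cong (_+_ cycleSum) (∑≢-reverse 5 [] F) ⟩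
      cycleSum + ∑≢ 5 [] (reverseArgs 5 F)  ≡⟨ ∑≢-⊕ 5 [] F (reverseArgs 5 F) ⟨
      ∑≢ 5 [] (F ⊕ reverseArgs 5 F)         ≡⟨ ∑≢-cong 5 [] (λ a b c d e _ → even-part a b c d e) ⟩
      ∑≢ 5 [] (+ 2 ⊛ ((λ _ _ _ _ _ → 1ℤ) ⊕ (K ⊕ K¹ ⊕ K² ⊕ K³ ⊕ K⁴)))
        ≡⟨ ∑≢-⊛ 5 [] (+ 2) ((λ _ _ _ _ _ → 1ℤ) ⊕ (K ⊕ K¹ ⊕ K² ⊕ K³ ⊕ K⁴)) ⟩
      + 2 * ∑≢ 5 [] ((λ _ _ _ _ _ → 1ℤ) ⊕ (K ⊕ K¹ ⊕ K² ⊕ K³ ⊕ K⁴))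
        ≡⟨ cong (_*_ (+ 2)) (trans (∑≢-⊕ 5 [] (λ _ _ _ _ _ → 1ℤ) (K ⊕ K¹ ⊕ K² ⊕ K³ ⊕ K⁴)) (cong₂ _+_ ∑≢-ones₅ rotations)) ⟩
      + 2 * (n- 0 * n- 1 * n- 2 * n- 3 * n- 4 + + 5 * (n- 4 * (n- 3 * P₂) + P₄)) ∎)
      where
      open ≡-Reasoning
      F G H I K K¹ K² K³ K⁴ : Fun n 5
      F a b c d e = (1ℤ + x a b) * (1ℤ + x b c) * (1ℤ + x c d) * (1ℤ + x d e) * (1ℤ + x e a)
      G a b c d e = x a b * x b c
      H a b c d e = x a b * x c d
      I a b c d e = x a b * x b c * x c d * x d e
      -- Each of the 15 nonconstant even monomials is a rotation of G, H or I.
      K  = G ⊕ H ⊕ I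
      K¹ = moveLast 4 K
      K² = moveLast 4 K¹
      K³ = moveLast 4 K²
      K⁴ = moveLast 4 K³
      double : ∀ i → + 2 * i ≡ i + i
      double = solve-∀
      expand : ∀ i j k l m →
        (1ℤ + i) * (1ℤ + j) * (1ℤ + k) * (1ℤ + l) * (1ℤ + m)
          + (1ℤ + - l) * (1ℤ + - k) * (1ℤ + - j) * (1ℤ + - i) * (1ℤ + - m)
        ≡ + 2 * (1ℤ + ((i * j + i * k + i * j * k * l) + (m * i + m * j + m * i * j * k) + (l * m + l * i + l * m * i * j)
                        + (k * l + k * m + k * l * m * i) + (j * k + j * l + j * k * l * m)))
      expand = solve-∀
      -- Rewriting with skew in place would make Agda normalise the integer products.
      expand-skew : ∀ {i j k l m i′ j′ k′ l′ m′} → i′ ≡ - i → j′ ≡ - j → k′ ≡ - k → l′ ≡ - l → m′ ≡ - m →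
        (1ℤ + i) * (1ℤ + j) * (1ℤ + k) * (1ℤ + l) * (1ℤ + m)
          + (1ℤ + l′) * (1ℤ + k′) * (1ℤ + j′) * (1ℤ + i′) * (1ℤ + m′)
        ≡ + 2 * (1ℤ + ((i * j + i * k + i * j * k * l) + (m * i + m * j + m * i * j * k) + (l * m + l * i + l * m * i * j)
                        + (k * l + k * m + k * l * m * i) + (j * k + j * l + j * k * l * m)))
      expand-skew {i} {j} {k} {l} {m} refl refl refl refl refl = expand i j k l m
      even-part : ∀ a b c d e → F a b c d e + F e d c b a
        ≡ + 2 * (1ℤ + (K a b c d e + K¹ a b c d e + K² a b c d e + K³ a b c d e + K⁴ a b c d e))
      even-part a b c d e = expand-skew {x a b} {x b c} {x c d} {x d e} {x e a}
        (skew a b) (skew b c) (skew c d) (skew d e) (skew e a)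
      -- Exchanging the ends of the first edge changes exactly one sign, the other edge being
      -- disjoint from it.
      H-odd : ∑≢ 5 [] H ≡ 0ℤ
      H-odd = ∑≢-odd 5 H (trans (∑≢-swap 3 [] H) (∑≢-cong 5 [] λ a b c d e _ → flip a b c d))
        where
        neg : ∀ i j → - i * j ≡ -1ℤ * (i * j)
        neg = solve-∀
        flip : ∀ a b c d → x b a * x c d ≡ -1ℤ * (x a b * x c d)
        flip a b c d = trans (cong (_* x c d) (skew a b)) (neg (x a b) (x c d))
      K-sum : ∑≢ 5 [] K ≡ n- 4 * (n- 3 * P₂) + P₄
      K-sum = begin
        ∑≢ 5 [] (G ⊕ H ⊕ I)           ≡⟨ ∑≢-⊕ 5 [] (G ⊕ H) I ⟩
        ∑≢ 5 [] (G ⊕ H) + P₄          ≡⟨ cong (_+ P₄) (∑≢-⊕ 5 [] G H) ⟩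
        ∑≢ 5 [] G + ∑≢ 5 [] H + P₄    ≡⟨ cong₂ (λ i j → i + j + P₄) G-sum H-odd ⟩
        n- 4 * (n- 3 * P₂) + 0ℤ + P₄  ≡⟨ cong (_+ P₄) (ℤ.+-identityʳ (n- 4 * (n- 3 * P₂))) ⟩
        n- 4 * (n- 3 * P₂) + P₄       ∎
        where
        G-sum : ∑≢ 5 [] G ≡ n- 4 * (n- 3 * P₂)
        G-sum = trans (∑≢-pad 4 [] λ a b c d → x a b * x b c) (cong (n- 4 *_) (∑≢-pad 3 [] λ a b c → x a b * x b c))
      rotate≡ : ∀ {s} (M : Fun n 5) → ∑≢ 5 [] M ≡ s → ∑≢ 5 [] (moveLast 4 M) ≡ s
      rotate≡ M M≡s = trans (sym (∑≢-moveLast 4 [] M)) M≡s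
      five : ∀ i → i + i + i + i + i ≡ + 5 * i
      five = solve-∀
      rotations : ∑≢ 5 [] (K ⊕ K¹ ⊕ K² ⊕ K³ ⊕ K⁴) ≡ + 5 * (n- 4 * (n- 3 * P₂) + P₄)
      rotations = begin
        ∑≢ 5 [] (K ⊕ K¹ ⊕ K² ⊕ K³ ⊕ K⁴)
          ≡⟨ trans (∑≢-⊕ 5 [] (K ⊕ K¹ ⊕ K² ⊕ K³) K⁴) (cong (_+ ∑≢ 5 [] K⁴)
             (trans (∑≢-⊕ 5 [] (K ⊕ K¹ ⊕ K²) K³) (cong (_+ ∑≢ 5 [] K³)
             (trans (∑≢-⊕ 5 [] (K ⊕ K¹) K²) (cong (_+ ∑≢ 5 [] K²) (∑≢-⊕ 5 [] K K¹)))))) ⟩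
        ∑≢ 5 [] K + ∑≢ 5 [] K¹ + ∑≢ 5 [] K² + ∑≢ 5 [] K³ + ∑≢ 5 [] K⁴
          ≡⟨ cong₂ _+_ (cong₂ _+_ (cong₂ _+_ (cong₂ _+_ K-sum K¹-sum) K²-sum) K³-sum) K⁴-sum ⟩
        s + s + s + s + s ≡⟨ five s ⟩
        + 5 * s ∎
        where
        s = n- 4 * (n- 3 * P₂) + P₄
        K¹-sum = rotate≡ K K-sum
        K²-sum = rotate≡ K¹ K¹-sum
        K³-sum = rotate≡ K² K²-sum
        K⁴-sum = rotate≡ K³ K³-sum

    -- The terms added on the left are the degree term and the `n C 3` term of the final bound,
    -- scaled by 20 from its integer form. The right side is arranged so that, from `n = 5` on, each
    -- summand after the falling factorial is visibly nonnegative.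
    cycleSum-identity : cycleSum + + 10 * (n- 2 * n- 3) * R + + 10 * (n- 0 * n- 1 * n- 2)
      ≡ n- 0 * n- 1 * n- 2 * n- 3 * n- 4
        + + 5 * (W₄ + (n- 0 * n- 1 * n- 2 * n- 3 - Q₄) + (n- 0 * n- 0 - + 6 * n- 0 + + 6) * R + n- 0 * (n- 1 * n- 1))
    cycleSum-identity = substitute cycleSum≡ P₄≡ P₂≡
      where
      identity : ∀ i w q s →
        (i - + 0) * (i - + 1) * (i - + 2) * (i - + 3) * (i - + 4)
          + + 5 * ((i - + 4) * ((i - + 3) * ((i - + 0) * (i - + 1) - s))
                   + (w - (i - + 1) * s - (i - + 2) * s + (i - + 3) * ((i - + 0) * (i - + 1) - s) - q))
          + + 10 * ((i - + 2) * (i - + 3)) * s + + 10 * ((i - + 0) * (i - + 1) * (i - + 2))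
        ≡ (i - + 0) * (i - + 1) * (i - + 2) * (i - + 3) * (i - + 4)
          + + 5 * (w + ((i - + 0) * (i - + 1) * (i - + 2) * (i - + 3) - q)
                   + ((i - + 0) * (i - + 0) - + 6 * (i - + 0) + + 6) * s + (i - + 0) * ((i - + 1) * (i - + 1)))
      identity = solve-∀
      -- Stated for arbitrary `z`, `p₄` and `p₂`, so that matching on `refl` eliminates them and a
      -- polynomial identity remains.
      substitute : ∀ {z p₄ p₂} →
        z ≡ n- 0 * n- 1 * n- 2 * n- 3 * n- 4 + + 5 * (n- 4 * (n- 3 * p₂) + p₄) →
        p₄ ≡ W₄ - n- 1 * R - n- 2 * R + n- 3 * p₂ - Q₄ →
        p₂ ≡ n- 0 * n- 1 - R →
        z + + 10 * (n- 2 * n- 3) * R + + 10 * (n- 0 * n- 1 * n- 2)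
        ≡ n- 0 * n- 1 * n- 2 * n- 3 * n- 4
          + + 5 * (W₄ + (n- 0 * n- 1 * n- 2 * n- 3 - Q₄) + (n- 0 * n- 0 - + 6 * n- 0 + + 6) * R + n- 0 * (n- 1 * n- 1))
      substitute refl refl refl = identity (+ n) W₄ Q₄ R

  -- Binomial coefficients as integers

  -- Induction through Pascal's rule, with the hypothesis used at both `suc k` and `k`. As the
  -- difference is taken in ℤ, the case `k > n` is covered: both sides are 0.
  C-absorption : ∀ n k → + suc k * + (n C suc k) ≡ (+ n - + k) * + (n C k)
  C-absorption zero k rewrite k>n⇒nCk≡0 {0} {suc k} (s≤s z≤n) with k
  ... | zero   = refl
  ... | suc k′ rewrite k>n⇒nCk≡0 {0} {suc k′} (s≤s z≤n) = trans (ℤ.*-zeroʳ (+ suc (suc k′))) (sym (ℤ.*-zeroʳ (+ 0 - + suc k′)))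
  C-absorption (suc n) zero = begin
    + 1 * + (suc n C 1)            ≡⟨ cong (λ m → + 1 * + m) (nCk+nC[k+1]≡[n+1]C[k+1] n 0) ⟨
    + 1 * (+ (n C 0) + + (n C 1))  ≡⟨ expand (+ (n C 0)) (+ (n C 1)) ⟩
    + (n C 0) + + 1 * + (n C 1)    ≡⟨ cong (_+_ (+ (n C 0))) (C-absorption n 0) ⟩
    + (n C 0) + (+ n - + 0) * + (n C 0) ≡⟨ collect (+ n) ⟩
    (+ 1 + + n - + 0) * + 1        ∎
    where
    open ≡-Reasoning
    expand : ∀ i j → + 1 * (i + j) ≡ i + + 1 * j
    expand = solve-∀
    collect : ∀ i → + 1 + (i - + 0) * + 1 ≡ (+ 1 + i - + 0) * + 1
    collect = solve-∀
  C-absorption (suc n) (suc k) = begin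
    + (2 ℕ.+ k) * + (suc n C suc (suc k))                ≡⟨ cong (λ m → + (2 ℕ.+ k) * + m) (nCk+nC[k+1]≡[n+1]C[k+1] n (suc k)) ⟨
    + (2 ℕ.+ k) * (u + + (n C suc (suc k)))              ≡⟨ ℤ.*-distribˡ-+ (+ (2 ℕ.+ k)) u (+ (n C suc (suc k))) ⟩
    + (2 ℕ.+ k) * u + + (2 ℕ.+ k) * + (n C suc (suc k))  ≡⟨ cong (_+_ (+ (2 ℕ.+ k) * u)) (C-absorption n (suc k)) ⟩
    -- One copy of `u` moves to the second term, so that the hypothesis at `k` applies to the first.
    + (2 ℕ.+ k) * u + (+ n - + suc k) * u                ≡⟨ regroup (+ n) (+ k) u ⟩
    + suc k * u + (+ n - + k) * u                        ≡⟨ cong (_+ (+ n - + k) * u) (C-absorption n k) ⟩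
    (+ n - + k) * t + (+ n - + k) * u                    ≡⟨ ℤ.*-distribˡ-+ (+ n - + k) t u ⟨
    (+ n - + k) * (t + u)                                ≡⟨ cong (λ m → (+ n - + k) * + m) (nCk+nC[k+1]≡[n+1]C[k+1] n k) ⟩
    (+ n - + k) * + (suc n C suc k)                      ≡⟨ cong (_* + (suc n C suc k)) (shift (+ n) (+ k)) ⟩
    (+ suc n - + suc k) * + (suc n C suc k)              ∎
    where
    open ≡-Reasoning
    t = + (n C k)
    u = + (n C suc k)
    regroup : ∀ i k u → (+ 2 + k) * u + (i - (+ 1 + k)) * u ≡ (+ 1 + k) * u + (i - k) * u
    regroup = solve-∀
    shift : ∀ i k → i - k ≡ (+ 1 + i) - (+ 1 + k)
    shift = solve-∀

  falling : ℕ → ℕ → ℤ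
  falling n zero    = 1ℤ
  falling n (suc k) = falling n k * (+ n - + k)

  C-falling : ∀ n k → + (k !) * + (n C k) ≡ falling n k
  C-falling n zero    = refl
  C-falling n (suc k) = begin
    + (suc k ℕ.* k !) * + (n C suc k)      ≡⟨ cong (_* + (n C suc k)) (ℤ.pos-* (suc k) (k !)) ⟩
    + suc k * + (k !) * + (n C suc k)      ≡⟨ rearrange (+ suc k) (+ (k !)) (+ (n C suc k)) ⟩
    + (k !) * (+ suc k * + (n C suc k))    ≡⟨ cong (_*_ (+ (k !))) (C-absorption n k) ⟩
    + (k !) * ((+ n - + k) * + (n C k))    ≡⟨ rearrange′ (+ (k !)) (+ n - + k) (+ (n C k)) ⟩
    + (k !) * + (n C k) * (+ n - + k)      ≡⟨ cong (_* (+ n - + k)) (C-falling n k) ⟩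
    falling n k * (+ n - + k)              ∎
    where
    open ≡-Reasoning
    rearrange : ∀ i j t → i * j * t ≡ j * (i * t)
    rearrange = solve-∀
    rearrange′ : ∀ i j t → i * (j * t) ≡ i * t * j
    rearrange′ = solve-∀

  -- Counting cycles up to rotation

  ⟦_⟧ : ∀ {P : Set} → Dec P → ℤ
  ⟦ P? ⟧ = if does P? then 1ℤ else 0ℤ

  ⟦⟧-Bit : ∀ {P : Set} (P? : Dec P) → Bit P ⟦ P? ⟧
  ⟦⟧-Bit (yes p) = one p
  ⟦⟧-Bit (no  _) = nil

  -- Links the arithmetic bits with any decision procedure for the same property, here `isCycle?`,
  -- without comparing how the two compute.
  Bit-≤ : ∀ {P : Set} {i} → Bit P i → (P? : Dec P) → i ≤ ⟦ P? ⟧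
  Bit-≤ (one p) (yes _) = ℤ.≤-refl
  Bit-≤ (one p) (no ¬p) = contradiction p ¬p
  Bit-≤ nil     (yes _) = +≤+ z≤n
  Bit-≤ nil     (no  _) = ℤ.≤-refl

  length-filter-∷ : ∀ {A : Set} {P : A → Set} (P? : U.Decidable P) a as →
                    + length (filter P? (a ∷ as)) ≡ ⟦ P? a ⟧ + + length (filter P? as)
  length-filter-∷ P? a as with does (P? a)
  ... | true  = refl
  ... | false = sym (ℤ.+-identityˡ _)

  length-filter-map : ∀ {A B : Set} {P : B → Set} (P? : U.Decidable P) (f : A → B) as →
                      length (filter P? (map f as)) ≡ length (filter (P? ∘ f) as)
  length-filter-map P? f []       = refl
  length-filter-map P? f (a ∷ as) with does (P? (f a))
  ... | true  = cong suc (length-filter-map P? f as)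
  ... | false = length-filter-map P? f as

  opaque
    unfolding ∑

    length-filter-tabulate : ∀ {A : Set} {P : A → Set} (P? : U.Decidable P) (f : Fin n → A) →
                             + length (filter P? (tabulate f)) ≡ ∑ (λ i → ⟦ P? (f i) ⟧)
    length-filter-tabulate {zero}  P? f = refl
    length-filter-tabulate {suc n} P? f = trans (length-filter-∷ P? (f zero) (tabulate (f ∘ suc)))
      (cong (_+_ ⟦ P? (f zero) ⟧) (length-filter-tabulate P? (f ∘ suc)))

    length-filter-cartesianProductWith : ∀ {A B D : Set} {P : D → Set} (P? : U.Decidable P) (g : A → B → D)
      (f : Fin n → A) bs → + length (filter P? (cartesianProductWith g (tabulate f) bs))
                           ≡ ∑ (λ i → + length (filter (P? ∘ g (f i)) bs))
    length-filter-cartesianProductWith {zero}  P? g f bs = refl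
    length-filter-cartesianProductWith {suc n} P? g f bs = begin
      + length (filter P? (map (g (f zero)) bs ++ cartesianProductWith g (tabulate (f ∘ suc)) bs))
        ≡⟨ cong (+_ ∘ length) (filter-++ P? (map (g (f zero)) bs) (cartesianProductWith g (tabulate (f ∘ suc)) bs)) ⟩
      + length (filter P? (map (g (f zero)) bs) ++ filter P? (cartesianProductWith g (tabulate (f ∘ suc)) bs))
        ≡⟨ cong +_ (length-++ (filter P? (map (g (f zero)) bs))) ⟩
      + length (filter P? (map (g (f zero)) bs)) + + length (filter P? (cartesianProductWith g (tabulate (f ∘ suc)) bs))
        ≡⟨ cong₂ _+_ (cong +_ (length-filter-map P? (g (f zero)) bs)) (length-filter-cartesianProductWith P? g (f ∘ suc) bs) ⟩
      ∑ (λ i → + length (filter (P? ∘ g (f i)) bs)) ∎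
      where open ≡-Reasoning

  ∑ⱽ : ∀ k → (Vec (Fin n) k → ℤ) → ℤ
  ∑ⱽ zero    f = f []
  ∑ⱽ (suc k) f = ∑ λ a → ∑ⱽ k λ v → f (a ∷ v)

  length-filter-allVecs : ∀ k {P : Vec (Fin n) k → Set} (P? : U.Decidable P) →
                          + length (filter P? (allVecs n k)) ≡ ∑ⱽ k (λ v → ⟦ P? v ⟧)
  length-filter-allVecs zero    P? = trans (length-filter-∷ P? [] []) (ℤ.+-identityʳ _)
  length-filter-allVecs {n} (suc k) P? = trans (length-filter-cartesianProductWith P? _∷_ id (allVecs n k))
    (∑-cong λ a → length-filter-allVecs k (P? ∘ (a ∷_)))

  allVecs-unique : ∀ n k → Uniqueˡ (allVecs n k)
  allVecs-unique n zero    = [] ∷ []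
  allVecs-unique n (suc k) = Unique.cartesianProductWith⁺ _∷_ ∷-injective (Unique.allFin⁺ n) (allVecs-unique n k)

  -- Pigeonhole principle: one occurrence of `x` is cut out of `ys`, and the tail of `xs` still lies
  -- in the remainder because `x` does not recur in it.
  unique-⊆-length : ∀ {A : Set} {xs ys : List A} → Uniqueˡ xs → xs ⊆ ys → length xs ℕ.≤ length ys
  unique-⊆-length []          xs⊆ys = z≤n
  unique-⊆-length {xs = x ∷ xs} (x∉xs ∷ xs!) xs⊆ys with ∈-∃++ (xs⊆ys (here refl))
  ... | as , bs , refl = subst (suc (length xs) ℕ.≤_) (sym (length-++-sucʳ as x bs)) (s≤s (unique-⊆-length xs! xs⊆as++bs))
    where
    xs⊆as++bs : xs ⊆ as ++ bs
    xs⊆as++bs z∈xs with ∈-++⁻ as (xs⊆ys (there z∈xs))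
    ... | inj₁ z∈as         = ∈-++⁺ˡ z∈as
    ... | inj₂ (here refl)  = contradiction refl (All.lookup x∉xs z∈xs)
    ... | inj₂ (there z∈bs) = ∈-++⁺ʳ as z∈bs

  length-concatMap : ∀ {A B : Set} (f : A → List B) k → (∀ a → length (f a) ≡ k) →
                     ∀ as → length (concatMap f as) ≡ length as ℕ.* k
  length-concatMap f k f≡k []       = refl
  length-concatMap f k f≡k (a ∷ as) = trans (length-++ (f a)) (cong₂ ℕ._+_ (f≡k a) (length-concatMap f k f≡k as))

  iterate-+ : ∀ {A : Set} (f : A → A) (x : A) m k → iterate f (iterate f x m) k ≡ iterate f x (m ℕ.+ k)
  iterate-+ f x zero    k = refl
  iterate-+ f x (suc m) k = iterate-+ f (f x) m k

  module _ {A : Set} where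

    rotate⁵ : (v : Vec A 5) → iterate rotate v 5 ≡ v
    rotate⁵ (a ∷ b ∷ c ∷ d ∷ e ∷ []) = refl

    orbit : Vec A 5 → List (Vec A 5)
    orbit v = tabulate {n = 5} λ i → iterate rotate v (toℕ i)

    iterate-mod-5 : ∀ (v : Vec A 5) m → ∃ λ (i : Fin 5) → iterate rotate v m ≡ iterate rotate v (toℕ i)
    iterate-mod-5 v 0 = zero , refl
    iterate-mod-5 v 1 = suc zero , refl
    iterate-mod-5 v 2 = suc (suc zero) , refl
    iterate-mod-5 v 3 = suc (suc (suc zero)) , refl
    iterate-mod-5 v 4 = suc (suc (suc (suc zero))) , refl
    iterate-mod-5 v (suc (suc (suc (suc (suc m))))) rewrite rotate⁵ v = iterate-mod-5 v m

    undo-rotation : ∀ (v : Vec A 5) (i : Fin 5) → ∃ λ k → iterate rotate (iterate rotate v (toℕ i)) k ≡ v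
    -- These further rotations complete a full turn of five.
    undo-rotation v i = 5 ℕ.∸ toℕ i , trans (iterate-+ rotate v (toℕ i) _)
      (trans (cong (iterate rotate v) (ℕ.m+[n∸m]≡n (ℕ.<⇒≤ (toℕ<n i)))) (rotate⁵ v))

  IsRotationOf-trans : {u v w : Vec (Fin n) 5} → u IsRotationOf v → v IsRotationOf w → u IsRotationOf w
  IsRotationOf-trans {w = w} (i , refl) (j , refl) with iterate-mod-5 w (toℕ j ℕ.+ toℕ i)
  ... | k , eq = k , trans (iterate-+ rotate w (toℕ j) (toℕ i)) eq

  IsRotationOf⇒∈-orbit : {u v : Vec (Fin n) 5} → u IsRotationOf v → v ∈ orbit u
  IsRotationOf⇒∈-orbit {v = v} (i , refl) with undo-rotation v i
  ... | k , undo with iterate-mod-5 (iterate rotate v (toℕ i)) k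
  ...   | j , eq = subst (_∈ orbit (iterate rotate v (toℕ i))) (trans (sym eq) undo)
                         (∈-tabulate⁺ {f = λ j → iterate rotate (iterate rotate v (toℕ i)) (toℕ j)} j)

  -- The orbit lists of the kept representatives, five entries each, together cover `L`, and `L` has
  -- no repetition.
  length≤5*deduplicate : ∀ {L : List (Vec (Fin n) 5)} → Uniqueˡ L → length L ℕ.≤ length (deduplicate isRotationOf? L) ℕ.* 5
  length≤5*deduplicate {L = L} L! = subst (length L ℕ.≤_) (length-concatMap orbit 5 (λ v → refl) reps) (unique-⊆-length L! covered)
    where
    reps = deduplicate isRotationOf? L
    covered : L ⊆ concatMap orbit reps
    covered {v} v∈L = ∈-concatMap⁺ orbit (Any.map IsRotationOf⇒∈-orbit
      -- A dropped vector has a kept rotation, so by transitivity some rotation of `v` survives; `v`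
      -- then lies in its orbit.
      (Any.deduplicate⁺ isRotationOf? {P = _IsRotationOf v} (λ r s → IsRotationOf-trans r s)
        (Any.map (λ { refl → zero , refl }) v∈L)))

  -- The sign matrix of a tournament.

  module TournamentMatrix {n : ℕ} (T : Tournament n) where
    open Tournament T

    arc : Fin n → Fin n → ℤ
    arc a b = ⟦ E? a b ⟧

    sgn : Fin n → Fin n → ℤ
    sgn a b = arc a b - arc b a

    sgn-skew : ∀ a b → sgn b a ≡ - sgn a b
    sgn-skew a b = flip-sub (arc a b) (arc b a)
      where
      flip-sub : ∀ i j → j - i ≡ - (i - j)
      flip-sub = solve-∀

    arc-diag : ∀ a → arc a a ≡ 0ℤ
    arc-diag a with E? a a
    ... | yes e = contradiction e (loopless a)
    ... | no  _ = refl

    arc-cases : ∀ {a b} → a ≢ b → (arc a b ≡ 1ℤ × arc b a ≡ 0ℤ) ⊎ (arc a b ≡ 0ℤ × arc b a ≡ 1ℤ)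
    arc-cases {a} {b} a≢b with E? a b | E? b a | exactlyOne a≢b
    ... | yes _ | no  _ | _ = inj₁ (refl , refl)
    ... | no  _ | yes _ | _ = inj₂ (refl , refl)
    ... | yes e | yes f | inj₁ (_ , ¬f) = contradiction f ¬f
    ... | yes e | yes f | inj₂ (¬e , _) = contradiction e ¬e
    ... | no ¬e | no ¬f | inj₁ (e , _)  = contradiction e ¬e
    ... | no ¬e | no ¬f | inj₂ (_ , f)  = contradiction f ¬f

    sgn-unit : ∀ {a b} → a ≢ b → Unit (sgn a b)
    sgn-unit a≢b with arc-cases a≢b
    ... | inj₁ (p , q) = inj₁ (cong₂ _-_ p q)
    ... | inj₂ (p , q) = inj₂ (cong₂ _-_ p q)

    2arc : ∀ {a b} → a ≢ b → 1ℤ + sgn a b ≡ + 2 * arc a b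
    2arc a≢b with arc-cases a≢b
    ... | inj₁ (p , q) rewrite p | q = refl
    ... | inj₂ (p , q) rewrite p | q = refl

    open SignMatrix sgn sgn-skew sgn-unit public

    -- Writing `ne a b` for the constant 1 makes the formula valid on the diagonal too; the factor
    -- `1ℤ` gives the term the shape that `∑-ne` sums.
    sgn≡ : ∀ a b → sgn a b ≡ + 2 * arc a b - ne a b * 1ℤ
    sgn≡ a b = by-cases (a ≟ b)
      where
      shift : ∀ i → i ≡ 1ℤ + i - 1ℤ
      shift = solve-∀
      by-cases : Dec (a ≡ b) → sgn a b ≡ + 2 * arc a b - ne a b * 1ℤ
      by-cases (yes refl) = trans (ℤ.+-inverseʳ (arc a a)) (sym (cong₂ (λ i j → + 2 * i - j * 1ℤ) (arc-diag a) (ne-refl a)))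
      by-cases (no a≢b)   = trans (shift (sgn a b)) (cong₂ (λ i j → i - j * 1ℤ) (2arc a≢b) (sym (≢⇒ne≡1 a≢b)))

    score : ∀ w → r w ≡ + 2 * + od w - (+ n - + 1)
    score w = begin
      ∑ (λ b → sgn w b)                                        ≡⟨ ∑-cong (sgn≡ w) ⟩
      ∑ (λ b → + 2 * arc w b - ne w b * 1ℤ)                    ≡⟨ ∑-cong (λ b → cong (_+_ (+ 2 * arc w b)) (sym (ℤ.-1*i≡-i (ne w b * 1ℤ)))) ⟩
      ∑ (λ b → + 2 * arc w b + -1ℤ * (ne w b * 1ℤ))            ≡⟨ ∑-+ (λ b → + 2 * arc w b) _ ⟩
      ∑ (λ b → + 2 * arc w b) + ∑ (λ b → -1ℤ * (ne w b * 1ℤ))  ≡⟨ cong₂ _+_ (∑-* (+ 2) (arc w)) (∑-* -1ℤ (λ b → ne w b * 1ℤ)) ⟩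
      + 2 * ∑ (arc w) + -1ℤ * ∑ (λ b → ne w b * 1ℤ)            ≡⟨ cong₂ (λ i j → + 2 * i + -1ℤ * j) (sym (length-filter-tabulate (E? w) id)) (trans (∑-ne w (λ _ → 1ℤ)) (cong (_- 1ℤ) (∑-const n 1ℤ))) ⟩
      + 2 * + od w + -1ℤ * (+ n * 1ℤ - 1ℤ)                     ≡⟨ tidy (+ od w) (+ n) ⟩
      + 2 * + od w - (+ n - + 1)                               ∎
      where
      open ≡-Reasoning
      tidy : ∀ i j → + 2 * i + -1ℤ * (j * 1ℤ - 1ℤ) ≡ + 2 * i - (j - + 1)
      tidy = solve-∀

    -- Compared term by term: a tuple with a repetition contributes 0, and on any other each factor
    -- is twice an arc indicator, which gives 32 times the indicator that all five arcs are present.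
    cycleSum≤ : cycleSum ≤ + 32 * ∑ⱽ 5 (λ v → ⟦ isCycle? T v ⟧)
    cycleSum≤ = begin
      cycleSum
        ≤⟨ (∑-mono λ a → ∑-mono λ b → ∑-mono λ c → ∑-mono λ d → ∑-mono λ e → bound a b c d e) ⟩
      ∑ (λ a → ∑ λ b → ∑ λ c → ∑ λ d → ∑ λ e → + 32 * ⟦ isCycle? T (a ∷ b ∷ c ∷ d ∷ e ∷ []) ⟧)
        ≡⟨ pull 5 (λ v → ⟦ isCycle? T v ⟧) ⟩
      + 32 * ∑ⱽ 5 (λ v → ⟦ isCycle? T v ⟧) ∎
      where
      open ℤ.≤-Reasoning
      pull : ∀ k (f : Vec (Fin n) k → ℤ) → ∑ⱽ k (λ v → + 32 * f v) ≡ + 32 * ∑ⱽ k f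
      pull zero    f = refl
      pull (suc k) f = trans (∑-cong λ a → pull k λ v → f (a ∷ v)) (∑-* (+ 32) _)
      twos : ∀ {i j k l m i′ j′ k′ l′ m′} → i′ ≡ + 2 * i → j′ ≡ + 2 * j → k′ ≡ + 2 * k → l′ ≡ + 2 * l → m′ ≡ + 2 * m →
             1ℤ * (i′ * j′ * k′ * l′ * m′) ≡ + 32 * (i * (j * (k * (l * m))))
      twos {i} {j} {k} {l} {m} refl refl refl refl refl = expand i j k l m
        where
        expand : ∀ i j k l m → 1ℤ * (+ 2 * i * (+ 2 * j) * (+ 2 * k) * (+ 2 * l) * (+ 2 * m)) ≡ + 32 * (i * (j * (k * (l * m))))
        expand = solve-∀
      bound : ∀ a b c d e → distinct (e ∷ d ∷ c ∷ b ∷ a ∷ [])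
                * ((1ℤ + sgn a b) * (1ℤ + sgn b c) * (1ℤ + sgn c d) * (1ℤ + sgn d e) * (1ℤ + sgn e a))
              ≤ + 32 * ⟦ isCycle? T (a ∷ b ∷ c ∷ d ∷ e ∷ []) ⟧
      bound a b c d e with distinct (e ∷ d ∷ c ∷ b ∷ a ∷ []) | distinct-Bit (e ∷ d ∷ c ∷ b ∷ a ∷ [])
      ... | _ | nil = ℤ.≤-trans (ℤ.≤-reflexive (ℤ.*-zeroˡ ((1ℤ + sgn a b) * (1ℤ + sgn b c) * (1ℤ + sgn c d) * (1ℤ + sgn d e) * (1ℤ + sgn e a))))
                                (ℤ.*-monoˡ-≤-nonNeg (+ 32) (Bit-≤ nil (isCycle? T (a ∷ b ∷ c ∷ d ∷ e ∷ []))))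
      ... | _ | one ((e≢d ∷ e≢c ∷ e≢b ∷ e≢a ∷ []) ∷ (d≢c ∷ d≢b ∷ d≢a ∷ []) ∷ (c≢b ∷ c≢a ∷ []) ∷ (b≢a ∷ []) ∷ [] ∷ []) =
        ℤ.≤-trans (ℤ.≤-reflexive (twos (2arc (≢-sym b≢a)) (2arc (≢-sym c≢b)) (2arc (≢-sym d≢c)) (2arc (≢-sym e≢d)) (2arc e≢a)))
                  (ℤ.*-monoˡ-≤-nonNeg (+ 32) (Bit-≤ (Bit-map cycle arcs) (isCycle? T (a ∷ b ∷ c ∷ d ∷ e ∷ []))))
        where
        arcs : Bit (E a b × E b c × E c d × E d e × E e a) (arc a b * (arc b c * (arc c d * (arc d e * arc e a))))
        arcs = ⟦⟧-Bit (E? a b) Bit-× (⟦⟧-Bit (E? b c) Bit-× (⟦⟧-Bit (E? c d) Bit-× (⟦⟧-Bit (E? d e) Bit-× ⟦⟧-Bit (E? e a))))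
        cycle : E a b × E b c × E c d × E d e × E e a → IsCycle T (a ∷ b ∷ c ∷ d ∷ e ∷ [])
        -- The bit lists vertices latest first and `Unique` earliest first, hence the reversed
        -- inequalities.
        cycle (ab , bc , cd , de , ea) =
          ((≢-sym b≢a ∷ ≢-sym c≢a ∷ ≢-sym d≢a ∷ ≢-sym e≢a ∷ []) ∷ (≢-sym c≢b ∷ ≢-sym d≢b ∷ ≢-sym e≢b ∷ [])
             ∷ (≢-sym d≢c ∷ ≢-sym e≢c ∷ []) ∷ (≢-sym e≢d ∷ []) ∷ [] ∷ [])
          , ab ∷ bc ∷ cd ∷ de ∷ ea ∷ []

    -- Here 160 = 32 · 5, as a directed 5-cycle accounts for at most five closed tuples.
    cycleSum≤160c : cycleSum ≤ + 160 * + c T 5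
    cycleSum≤160c = begin
      cycleSum                                             ≤⟨ cycleSum≤ ⟩
      + 32 * ∑ⱽ 5 (λ v → ⟦ isCycle? T v ⟧)                 ≡⟨ cong (_*_ (+ 32)) (length-filter-allVecs 5 (isCycle? T)) ⟨
      + 32 * + length (filter (isCycle? T) (allVecs n 5))  ≤⟨ ℤ.*-monoˡ-≤-nonNeg (+ 32) (+≤+ (length≤5*deduplicate (Unique.filter⁺ (isCycle? T) (allVecs-unique n 5)))) ⟩
      + 32 * + (c T 5 ℕ.* 5)                               ≡⟨ cong (_*_ (+ 32)) (ℤ.pos-* (c T 5) 5) ⟩
      + 32 * (+ c T 5 * + 5)                               ≡⟨ tidy (+ c T 5) ⟩
      + 160 * + c T 5                                      ∎
      where
      open ℤ.≤-Reasoning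
      tidy : ∀ i → + 32 * (i * + 5) ≡ + 160 * i
      tidy = solve-∀

    R≥0 : 0ℤ ≤ R
    R≥0 = ∑-nonneg λ a → square-nonneg (r a)

    -- The hypothesis n² − 6 n + 6 ≥ 0 fails exactly for n = 2, 3, 4.
    falling≤ : 0ℤ ≤ n- 0 * n- 0 - + 6 * n- 0 + + 6 →
      n- 0 * n- 1 * n- 2 * n- 3 * n- 4 ≤ + 160 * + c T 5 + + 10 * (n- 2 * n- 3) * R + + 10 * (n- 0 * n- 1 * n- 2)
    falling≤ coeff≥0 = begin
      A₅                        ≡⟨ ℤ.+-identityʳ A₅ ⟨
      A₅ + + 5 * 0ℤ             ≤⟨ ℤ.+-monoʳ-≤ A₅ (ℤ.*-monoˡ-≤-nonNeg (+ 5) slack≥0) ⟩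
      A₅ + + 5 * (W₄ + (n- 0 * n- 1 * n- 2 * n- 3 - Q₄) + (n- 0 * n- 0 - + 6 * n- 0 + + 6) * R + n- 0 * (n- 1 * n- 1))
        ≡⟨ cycleSum-identity ⟨
      cycleSum + + 10 * (n- 2 * n- 3) * R + + 10 * (n- 0 * n- 1 * n- 2)
        ≤⟨ ℤ.+-monoˡ-≤ _ (ℤ.+-monoˡ-≤ (+ 10 * (n- 2 * n- 3) * R) cycleSum≤160c) ⟩
      + 160 * + c T 5 + + 10 * (n- 2 * n- 3) * R + + 10 * (n- 0 * n- 1 * n- 2) ∎
      where
      open ℤ.≤-Reasoning
      A₅ : ℤ
      A₅ = n- 0 * n- 1 * n- 2 * n- 3 * n- 4
      n≥0 : 0ℤ ≤ n- 0
      n≥0 = subst (0ℤ ≤_) (sym (ℤ.+-identityʳ (+ n))) (+≤+ z≤n)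
      slack≥0 : 0ℤ ≤ W₄ + (n- 0 * n- 1 * n- 2 * n- 3 - Q₄) + (n- 0 * n- 0 - + 6 * n- 0 + + 6) * R + n- 0 * (n- 1 * n- 1)
      slack≥0 = ℤ.+-mono-≤ (ℤ.+-mono-≤ (ℤ.+-mono-≤ (∑-nonneg λ a → square-nonneg (q a)) (ℤ.i≤j⇒0≤j-i Q₄≤))
        (*-nonneg coeff≥0 R≥0)) (*-nonneg n≥0 (square-nonneg (n- 1)))

    -- This settles `n ≤ 4`, where `n C 5` is 0.
    0≤bound : 0ℤ ≤ + 8 * + c T 5 + + ((n ∸ 2) C 2) * R + + 3 * + (n C 3)
    0≤bound = ℤ.+-mono-≤ (ℤ.+-mono-≤ (*-nonneg (+≤+ (z≤n {8})) (+≤+ (z≤n {c T 5}))) (*-nonneg (+≤+ (z≤n {(n ∸ 2) C 2})) R≥0))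
                       (*-nonneg (+≤+ (z≤n {3})) (+≤+ (z≤n {n C 3})))

  -- The theorem multiplied by 8. The sum of squared deviations is a quarter of `R`, so the degree
  -- term gets the coefficient 8 · 1/2 · 1/4 = 1.
  integer-bound : ∀ n (T : Tournament n) →
    + 6 * + (n C 5) ≤ + 8 * + c T 5 + + ((n ∸ 2) C 2) * TournamentMatrix.R T + + 3 * + (n C 3)
  integer-bound 0 T = TournamentMatrix.0≤bound T
  integer-bound 1 T = TournamentMatrix.0≤bound T
  integer-bound 2 T = TournamentMatrix.0≤bound T
  integer-bound 3 T = TournamentMatrix.0≤bound T
  integer-bound 4 T = TournamentMatrix.0≤bound T
  -- The factor 20 turns 6 into 5!, so that the left side becomes a falling factorial.
  integer-bound n@(suc (suc (suc (suc (suc m))))) T = ℤ.*-cancelˡ-≤-pos _ _ (+ 20) (begin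
    + 20 * (+ 6 * + (n C 5))  ≡⟨ assoc (+ (n C 5)) ⟩
    + (5 !) * + (n C 5)       ≡⟨ C-falling n 5 ⟩
    falling n 5               ≡⟨ refold (+ n) ⟩
    _                         ≤⟨ TournamentMatrix.falling≤ T coeff≥0 ⟩
    _                         ≡⟨ regroup (+ m) (+ c T 5) (+ ((n ∸ 2) C 2)) (+ (n C 3)) (TournamentMatrix.R T) (C-falling (3 ℕ.+ m) 2) (C-falling n 3) ⟩
    + 20 * (+ 8 * + c T 5 + + ((n ∸ 2) C 2) * TournamentMatrix.R T + + 3 * + (n C 3)) ∎)
    where
    open ℤ.≤-Reasoning
    assoc : ∀ i → + 20 * (+ 6 * i) ≡ + 120 * i
    assoc = solve-∀
    refold : ∀ i → + 1 * (i - + 0) * (i - + 1) * (i - + 2) * (i - + 3) * (i - + 4)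
                   ≡ (i - + 0) * (i - + 1) * (i - + 2) * (i - + 3) * (i - + 4)
    refold = solve-∀
    coeff : ∀ i → + 1 + i * (i + + 4) ≡ (+ 5 + i - + 0) * (+ 5 + i - + 0) - + 6 * (+ 5 + i - + 0) + + 6
    coeff = solve-∀
    -- With n = m + 5 it reads m² + 4 m + 1 ≥ 0.
    coeff≥0 : 0ℤ ≤ (+ n - + 0) * (+ n - + 0) - + 6 * (+ n - + 0) + + 6
    coeff≥0 = subst (0ℤ ≤_) (coeff (+ m)) (ℤ.+-mono-≤ (+≤+ (z≤n {1})) (*-nonneg (+≤+ (z≤n {m})) (+≤+ (z≤n {m ℕ.+ 4}))))
    regroup : ∀ i c u v s → + 2 * u ≡ + 1 * (+ 3 + i - + 0) * (+ 3 + i - + 1) →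
              + 6 * v ≡ + 1 * (+ 5 + i - + 0) * (+ 5 + i - + 1) * (+ 5 + i - + 2) →
              + 160 * c + + 10 * ((+ 5 + i - + 2) * (+ 5 + i - + 3)) * s + + 10 * ((+ 5 + i - + 0) * (+ 5 + i - + 1) * (+ 5 + i - + 2))
              ≡ + 20 * (+ 8 * c + u * s + + 3 * v)
    regroup i c u v s 2u 6v = trans (refactor i c s) (trans (cong₂ (λ j k → + 160 * c + + 10 * j * s + + 10 * k) (sym 2u) (sym 6v)) (collect c u v s))
      where
      refactor : ∀ i c s →
              + 160 * c + + 10 * ((+ 5 + i - + 2) * (+ 5 + i - + 3)) * s + + 10 * ((+ 5 + i - + 0) * (+ 5 + i - + 1) * (+ 5 + i - + 2))
              ≡ + 160 * c + + 10 * (+ 1 * (+ 3 + i - + 0) * (+ 3 + i - + 1)) * s + + 10 * (+ 1 * (+ 5 + i - + 0) * (+ 5 + i - + 1) * (+ 5 + i - + 2))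
      refactor = solve-∀
      collect : ∀ c u v s → + 160 * c + + 10 * (+ 2 * u) * s + + 10 * (+ 6 * v) ≡ + 20 * (+ 8 * c + u * s + + 3 * v)
      collect = solve-∀

open import Data.Rational.Base as ℚ using (ℚ; _≥_; _-_; _*_; _/_; ½)
import Data.Rational.Properties as ℚ
open import Data.Rational.Literals using (fromℤ)
open import Data.Rational.Properties using (+-0-commutativeMonoid)
open import Data.Rational.Solver using (module +-*-Solver)
open import Algebra.Properties.CommutativeMonoid.Sum +-0-commutativeMonoid as ℚSum using (sum-syntax)

-- From integers to rationals

-- Passing to `fromℤ`, whose denominator is literally 1, avoids the reduction to lowest terms
-- performed by `_/_`.
/1≡fromℤ : ∀ i → i / 1 ≡ fromℤ i
/1≡fromℤ i = ℚ.↥p/↧p≡p (fromℤ i)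

fromℤ-+ : ∀ i j → fromℤ (i ℤ.+ j) ≡ fromℤ i ℚ.+ fromℤ j
fromℤ-+ i j = sym (trans (cong (_/ 1) (cong₂ ℤ._+_ (ℤ.*-identityʳ i) (ℤ.*-identityʳ j))) (/1≡fromℤ (i ℤ.+ j)))

fromℤ-* : ∀ i j → fromℤ (i ℤ.* j) ≡ fromℤ i * fromℤ j
fromℤ-* i j = sym (/1≡fromℤ (i ℤ.* j))

fromℤ-mono-≤ : ∀ {i j} → i ℤ.≤ j → fromℤ i ℚ.≤ fromℤ j
fromℤ-mono-≤ {i} {j} i≤j = ℚ.*≤* (ℤ.*-monoʳ-≤-nonNeg (+ 1) i≤j)

/2≡½* : ∀ i → i / 2 ≡ ½ * fromℤ i
/2≡½* i = cong (_/ 2) (sym (ℤ.*-identityˡ i))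

opaque
  unfolding ∑

  fromℤ-∑ : ∀ {n} (f : Fin n → ℤ) → fromℤ (∑ f) ≡ ∑[ i < n ] fromℤ (f i)
  fromℤ-∑ {zero}  f = refl
  fromℤ-∑ {suc n} f = trans (fromℤ-+ (f zero) (∑ λ i → f (suc i))) (cong (ℚ._+_ (fromℤ (f zero))) (fromℤ-∑ λ i → f (suc i)))

∑ℚ-* : ∀ {n} c (f : Fin n → ℚ) → ∑[ i < n ] (c * f i) ≡ c * ∑[ i < n ] f i
∑ℚ-* {zero}  c f = sym (ℚ.*-zeroʳ c)
∑ℚ-* {suc n} c f = trans (cong (ℚ._+_ (c * f zero)) (∑ℚ-* c λ i → f (suc i))) (sym (ℚ.*-distribˡ-+ c (f zero) _))

open +-*-Solver using (solve; con; _:=_; _:*_; _:+_; _:-_)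

-- By `score` the deviation is half of the row sum `r w`, which gives the factor 1/4.
deviation-square : ∀ {n} (T : Tournament n) w → let open TournamentMatrix T in
  (fromℕ (Tournament.od T w) - (+ n ℤ.- + 1) / 2) ² ≡ (+ 1 / 4) * fromℤ (r w ℤ.* r w)
deviation-square {n} T w = begin
  (fromℕ (od w) - (+ n ℤ.- + 1) / 2) ²
    ≡⟨ cong₂ (λ p q → (p - q) ²) (/1≡fromℤ (+ od w)) (/2≡½* (+ n ℤ.- + 1)) ⟩
  (fromℤ (+ od w) - ½ * fromℤ (+ n ℤ.- + 1)) ²
    ≡⟨ solve 2 (λ p q → (p :- con ½ :* q) :* (p :- con ½ :* q) := con (+ 1 / 4) :* ((con (+ 2 / 1) :* p :- q) :* (con (+ 2 / 1) :* p :- q)))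
         refl (fromℤ (+ od w)) (fromℤ (+ n ℤ.- + 1)) ⟩
  (+ 1 / 4) * (fromℤ (+ 2) * fromℤ (+ od w) - fromℤ (+ n ℤ.- + 1)) ²
    ≡⟨ cong (λ p → (+ 1 / 4) * p ²) rational-score ⟨
  (+ 1 / 4) * (fromℤ (r w)) ²
    ≡⟨ cong (_*_ (+ 1 / 4)) (fromℤ-* (r w) (r w)) ⟨
  (+ 1 / 4) * fromℤ (r w ℤ.* r w) ∎
  where
  open ≡-Reasoning
  open Tournament T using (od)
  open TournamentMatrix T
  fromℤ-neg : ∀ i → fromℤ (ℤ.- i) ≡ ℚ.- fromℤ i
  fromℤ-neg (+ 0)        = refl
  fromℤ-neg ℤ.+[1+ _ ] = refl
  fromℤ-neg ℤ.-[1+ _ ] = refl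
  rational-score : fromℤ (r w) ≡ fromℤ (+ 2) * fromℤ (+ od w) - fromℤ (+ n ℤ.- + 1)
  rational-score = trans (cong fromℤ (score w)) (trans (fromℤ-+ (+ 2 ℤ.* + od w) (ℤ.- (+ n ℤ.- + 1)))
    (cong₂ ℚ._+_ (fromℤ-* (+ 2) (+ od w)) (fromℤ-neg (+ n ℤ.- + 1))))

∑-deviation-square : ∀ {n} (T : Tournament n) →
  ∑[ w < n ] ((fromℕ (Tournament.od T w) - (+ n ℤ.- + 1) / 2) ²) ≡ (+ 1 / 4) * fromℤ (TournamentMatrix.R T)
∑-deviation-square {n} T = trans (ℚSum.sum-cong-≗ (deviation-square T)) (trans (∑ℚ-* (+ 1 / 4) λ w → fromℤ (r w ℤ.* r w)) (cong (_*_ (+ 1 / 4)) (sym (fromℤ-∑ λ w → r w ℤ.* r w))))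
  where
  open TournamentMatrix T

corollary2p3 : ∀ (n : ℕ) (T : Tournament n) → fromℕ (c T 5) ≥ (+ 3 / 4) * fromℕ (n C 5) - (+ 1 / 2) * fromℕ ((n ∸ 2) C 2) * (∑[ w < n ] ((fromℕ (Tournament.od T w) - (+ n ℤ.- + 1) / 2) ²)) - (+ 3 / 8) * fromℕ (n C 3)
corollary2p3 n T = begin
  (+ 3 / 4) * fromℕ (n C 5) - (+ 1 / 2) * fromℕ ((n ∸ 2) C 2) * (∑[ w < n ] ((fromℕ (Tournament.od T w) - (+ n ℤ.- + 1) / 2) ²)) - (+ 3 / 8) * fromℕ (n C 3)
    ≡⟨ cong₂ _-_ (cong₂ _-_ (cong (_*_ (+ 3 / 4)) (/1≡fromℤ (+ (n C 5))))
                            (cong₂ (λ p q → (+ 1 / 2) * p * q) (/1≡fromℤ (+ ((n ∸ 2) C 2))) (∑-deviation-square T)))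
                 (cong (_*_ (+ 3 / 8)) (/1≡fromℤ (+ (n C 3)))) ⟩
  (+ 3 / 4) * u - (+ 1 / 2) * v * ((+ 1 / 4) * s) - (+ 3 / 8) * t
    -- The common denominator is 8, because 1/2 · 1/4 = 1/8; what remains in the bracket is governed
    -- by the integer bound.
    ≡⟨ solve 4 (λ u v s t → con (+ 3 / 4) :* u :- con (+ 1 / 2) :* v :* (con (+ 1 / 4) :* s) :- con (+ 3 / 8) :* t
                 := con (+ 1 / 8) :* (con (+ 6 / 1) :* u :- (v :* s :+ con (+ 3 / 1) :* t))) refl u v s t ⟩
  (+ 1 / 8) * (fromℤ (+ 6) * u - (v * s ℚ.+ fromℤ (+ 3) * t))
    ≤⟨ ℚ.*-monoˡ-≤-nonNeg (+ 1 / 8) (ℚ.+-monoˡ-≤ (ℚ.- (v * s ℚ.+ fromℤ (+ 3) * t)) rational-bound) ⟩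
  (+ 1 / 8) * (fromℤ (+ 8) * y ℚ.+ v * s ℚ.+ fromℤ (+ 3) * t - (v * s ℚ.+ fromℤ (+ 3) * t))
    ≡⟨ solve 3 (λ y p q → con (+ 1 / 8) :* (con (+ 8 / 1) :* y :+ p :+ q :- (p :+ q)) := y) refl y (v * s) (fromℤ (+ 3) * t) ⟩
  y
    ≡⟨ /1≡fromℤ (+ c T 5) ⟨
  fromℕ (c T 5) ∎
  where
  open ℚ.≤-Reasoning
  y u v s t : ℚ
  y = fromℤ (+ c T 5)
  u = fromℤ (+ (n C 5))
  v = fromℤ (+ ((n ∸ 2) C 2))
  s = fromℤ (TournamentMatrix.R T)
  t = fromℤ (+ (n C 3))
  rational-bound : fromℤ (+ 6) * u ℚ.≤ fromℤ (+ 8) * y ℚ.+ v * s ℚ.+ fromℤ (+ 3) * t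
  rational-bound = subst (ℚ._≤ fromℤ (+ 8) * y ℚ.+ v * s ℚ.+ fromℤ (+ 3) * t) (fromℤ-* (+ 6) (+ (n C 5))) (ℚ.≤-trans (fromℤ-mono-≤ (integer-bound n T)) (ℚ.≤-reflexive
    (trans (fromℤ-+ (+ 8 ℤ.* + c T 5 ℤ.+ + ((n ∸ 2) C 2) ℤ.* TournamentMatrix.R T) (+ 3 ℤ.* + (n C 3)))
      (cong₂ ℚ._+_ (trans (fromℤ-+ (+ 8 ℤ.* + c T 5) (+ ((n ∸ 2) C 2) ℤ.* TournamentMatrix.R T))
                          (cong₂ ℚ._+_ (fromℤ-* (+ 8) (+ c T 5)) (fromℤ-* (+ ((n ∸ 2) C 2)) (TournamentMatrix.R T))))
                   (fromℤ-* (+ 3) (+ (n C 3)))))))
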